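{- Let $G=(V,E,I,\varsigma,\omega,\sigma)$ be an oriented hypergraph with Laplacian matrix $\mathbf{L}_G$, and let $\mathbf{X}=(x_{u,w})_{u,w\in V}$ be the $V\times V$ matrix of independent indeterminates. Then the total-minor polynomial $\chi(\mathbf{L}_G,\mathbf{X}):=\det(\mathbf{X}-\mathbf{L}_G)$ satisfies $$\chi(\mathbf{L}_G,\mathbf{X})=\sum_{[\mathbf{u},\mathbf{w}]}\left(\sum_{c\in\hat{\mathfrak{M}}_{\neq 0}(G^0;\mathbf{u},\mathbf{w})}\operatorname{csgn}(c)\right)\prod_i x_{u_i,w_i},$$ where $\hat{\mathfrak{M}}_{\neq 0}(G^0;\mathbf{u},\mathbf{w})$ is the set of edge-monic non-zero reduced $[\mathbf{u},\mathbf{w}]$-equivalent contributors.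
   Context: An oriented hypergraph is a sextuple $G=(V,E,I,\varsigma,\omega,\sigma)$ with finite sets $V$ (vertices), $E$ (edges), $I$ (incidences) and functions $\varsigma:I\to V$ (port), $\omega:I\to E$ (attachment), $\sigma:I\to\{+1,-1\}$ (incidence signs). Several incidences may have the same port and attachment. The incidence matrix $\mathbf{H}_G$ is the $V\times E$ matrix whose $(v,e)$-entry is the sum of $\sigma(i)$ over all $i\in I$ with $\varsigma(i)=v$, $\omega(i)=e$. The Laplacian is $\mathbf{L}_G=\mathbf{H}_G\mathbf{H}_G^{T}$. The outer sum is over all pairs $[\mathbf{u},\mathbf{w}]$ consisting of subsets $U,W\subseteq V$ with $|U|=|W|$ and a bijection $U\to W$, written $u_i\mapsto w_i$ with $\mathbf{u}=(u_1,u_2,\dots)$, $\mathbf{w}=(w_1,w_2,\dots)$ orderings of $U$ and $W$; each triple ($U$, $W$, bijection) is counted exactly once, and $U=W=\emptyset$ and $U=W=V$ are allowed. A contributor of a hypergraph assigns to every $v\in V$ a step $(v,i_v,e_v,j_v,\pi(v))$, where $i_v,j_v$ are incidences (possibly equal), $\omega(i_v)=\omega(j_v)=e_v$, $\varsigma(i_v)=v$, $\varsigma(j_v)=\pi(v)$, such that $\pi$ is a permutation of $V$. A $[\mathbf{u},\mathbf{w}]$-reduced contributor is what remains of a contributor with $\pi(u_i)=w_i$ for all $i$ after the steps at the vertices $u_i$ are removed. These are formed in the zero-loading $G^0$ of $G$ (in which missing incidences are added with weight $0$, so that the removed steps need not exist in $G$), and "non-zero" means that all the remaining steps lie in $G$.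 Concretely, an element of $\hat{\mathfrak{C}}_{\neq0}(G^0;\mathbf{u},\mathbf{w})$ is a family $c$ of steps $(v,i_v,e_v,j_v,\pi(v))$ of $G$, one for each $v\in V\setminus U$, with $\omega(i_v)=\omega(j_v)=e_v$, $\varsigma(i_v)=v$, $\varsigma(j_v)=\pi(v)$, such that $\pi$ is a bijection $V\setminus U\to V\setminus W$. Such a $c$ is edge-monic if $e_v\ne e_w$ for all distinct $v,w\in V\setminus U$; $\hat{\mathfrak{M}}_{\neq0}(G^0;\mathbf{u},\mathbf{w})$ denotes the subset of edge-monic elements. The step at $v$ is a backstep if $i_v=j_v$; otherwise it is an adjacency (a loop if moreover $\pi(v)=v$). The contributor sign is $\operatorname{csgn}(c)=(-1)^{ec(\check c)+nc(c)+bs(c)}$, where: $ec(\check c)$ is the number of cycles of even length of the permutation of $V$ that extends $\pi$ by $u_i\mapsto w_i$; $bs(c)$ is the number of backsteps of $c$; and $nc(c)$ is the number of negative components of $c$. The components of $c$ are those of the directed graph on $V$ with one arc $v\to\pi(v)$ for each $v\in V\setminus U$ (each is a directed cycle or a directed path); a component that is not a backstep and consists of the steps at $v_1,\dots,v_k$ is negative if $(-1)^k\prod_{l=1}^k\sigma(i_{v_l})\sigma(j_{v_l})=-1$. Backsteps are not counted in $nc$. -}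

module Defs where

open import Algebra.Bundles.Raw using (RawRing)
open import Data.Bool.Base using (if_then_else_)
import Data.Bool.Properties as Bool
open import Data.Fin.Base using (Fin; combine; _<_; _≤_)
import Data.Fin.Properties as Fin
open import Data.Integer.Base as ℤ using (ℤ; _◃_; 0ℤ; 1ℤ; -1ℤ)
import Data.Integer.Properties as ℤ
open import Data.List.Base
  using (List; []; _∷_; [_]; _++_; map; foldr; filter; length; allFin; cartesianProduct; cartesianProductWith; mapMaybe)
open import Data.List.Membership.Propositional using (_∈_)
open import Data.List.Membership.Propositional.Properties using (∈-allFin)
open import Data.List.Relation.Unary.Any using (here; there)
open import Data.Maybe.Base as Maybe using (Maybe; just; nothing; is-just; is-nothing; maybe; _<∣>_)
import Data.Maybe.Properties as Maybe
open import Data.Maybe.Relation.Unary.All as All using (All)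
open import Data.Nat.Base as ℕ using (ℕ; zero; suc)
import Data.Nat.Properties as ℕ
open import Data.Nat.Divisibility using (_∣?_)
open import Data.Product.Base using (∃-syntax; _×_; _,_; proj₁; proj₂)
import Data.Product.Properties as Product
open import Data.Sign.Base using (Sign)
open import Data.Sum.Base using (_⊎_; inj₁; inj₂)
open import Data.Vec.Base as Vec using (Vec; []; _∷_; lookup; replicate; zipWith; updateAt)
import Data.Vec.Properties as Vec
open import Function.Base using (_∘_)
open import Level using (Level; 0ℓ)
open import Relation.Binary.Construct.Closure.Equivalence using (EqClosure)
open import Relation.Binary.Construct.Closure.ReflexiveTransitive using (Star; ε; _◅_; _◅◅_)
open import Relation.Binary.Construct.Closure.Symmetric using (SymClosure; fwd; bwd)
open import Relation.Binary.Core using (Rel)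
open import Relation.Binary.Definitions using (Decidable)
open import Relation.Binary.PropositionalEquality using (_≡_; refl)
open import Relation.Nullary using (¬_; Dec; does; ¬?)
open import Relation.Nullary.Decidable using (map′; _×-dec_; _→-dec_; _⊎-dec_)
import Relation.Unary as U

private
  variable
    a ℓ : Level
    A : Set a
    m n k : ℕ

vectorsOver : List A → (n : ℕ) → List (Vec A n)
vectorsOver xs zero    = [ [] ]
vectorsOver xs (suc n) = cartesianProductWith _∷_ xs (vectorsOver xs n)

allMaybe : List A → List (Maybe A)
allMaybe xs = nothing ∷ map just xs

count : {P : U.Pred (Fin n) ℓ} → U.Decidable P → ℕ
count {n = n} P? = length (filter P? (allFin n))

------------------------------------------------------------------------
-- Sums, products and determinants over a ring

module _ (R : RawRing a ℓ) where
  open RawRing R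

  sumOver : {B : Set} → List B → (B → Carrier) → Carrier
  sumOver xs f = foldr _+_ 0# (map f xs)

  prodOver : {B : Set} → List B → (B → Carrier) → Carrier
  prodOver xs f = foldr _*_ 1# (map f xs)

-- On a finite set, injective self-maps are bijective.
IsPermutation : Vec (Fin n) n → Set
IsPermutation π = ∀ u v → lookup π u ≡ lookup π v → u ≡ v

isPermutation? : U.Decidable (IsPermutation {n})
isPermutation? π = Fin.all? λ u → Fin.all? λ v →
  (lookup π u Fin.≟ lookup π v) →-dec (u Fin.≟ v)

permutations : (n : ℕ) → List (Vec (Fin n) n)
permutations n = filter isPermutation? (vectorsOver (allFin n) n)

Inversion : Vec (Fin n) n → Fin n × Fin n → Set
Inversion π (u , v) = u < v × lookup π v < lookup π u

inversion? : (π : Vec (Fin n) n) → U.Decidable (Inversion π)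
inversion? π (u , v) = (u Fin.<? v) ×-dec (lookup π v Fin.<? lookup π u)

inversions : Vec (Fin n) n → ℕ
inversions {n} π = length (filter (inversion? π) (cartesianProduct (allFin n) (allFin n)))

module _ (R : RawRing a ℓ) where
  open RawRing R

  signOf : Vec (Fin n) n → Carrier
  signOf π = if does (2 ∣? inversions π) then 1# else - 1#

  det : (Fin n → Fin n → Carrier) → Carrier
  det {n} M = sumOver R (permutations n) λ π →
    signOf π * prodOver R (allFin n) λ v → M v (lookup π v)

------------------------------------------------------------------------
-- The polynomial ring ℤ[X₁,…,Xₖ]

-- The vector of exponents.
Monomial : ℕ → Set
Monomial k = Vec ℕ k

-- A formal sum of terms, not necessarily collected; polynomials are
-- identified when all their coefficients agree.
Poly : ℕ → Set
Poly k = List (ℤ × Monomial k)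

coeff : Poly k → Monomial k → ℤ
coeff p μ = foldr ℤ._+_ 0ℤ (map proj₁ (filter (λ t → Vec.≡-dec ℕ._≟_ (proj₂ t) μ) p))

infix 4 _≈ₚ_
_≈ₚ_ : Rel (Poly k) 0ℓ
p ≈ₚ q = ∀ μ → coeff p μ ≡ coeff q μ

constant : ℤ → Poly k
constant c = [ c , replicate _ 0 ]

indeterminate : Fin k → Poly k
indeterminate i = [ 1ℤ , updateAt (replicate _ 0) i suc ]

polyRing : ℕ → RawRing 0ℓ 0ℓ
polyRing k = record
  { Carrier = Poly k
  ; _≈_     = _≈ₚ_
  ; _+_     = _++_
  ; _*_     = cartesianProductWith λ (b , μ) (c , ν) → b ℤ.* c , zipWith ℕ._+_ μ ν
  ; -_      = map λ (b , μ) → ℤ.- b , μ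
  ; 0#      = []
  ; 1#      = constant 1ℤ
  }

-- ℤ[x_{u,w} : u, w ∈ Fin n]
MatrixPolyRing : ℕ → RawRing 0ℓ 0ℓ
MatrixPolyRing n = polyRing (n ℕ.* n)

x : Fin n → Fin n → RawRing.Carrier (MatrixPolyRing n)
x u w = indeterminate (combine u w)

totalMinorPolynomial : (Fin n → Fin n → ℤ) → RawRing.Carrier (MatrixPolyRing n)
totalMinorPolynomial {n} L = det (MatrixPolyRing n) λ u w → x u w + - constant (L u w)
  where open RawRing (MatrixPolyRing n)

------------------------------------------------------------------------
-- Decidability of the reflexive transitive closure on Fin n

private
  module Reachability {R : Rel (Fin n) ℓ} (R? : Decidable R) where

    -- Reachability with all intermediate vertices in the given list.
    Via : List (Fin n) → Rel (Fin n) ℓ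
    Via []       u w = u ≡ w ⊎ R u w
    Via (v ∷ vs) u w = Via vs u w ⊎ (Via vs u v × Via vs v w)

    via? : ∀ vs → Decidable (Via vs)
    via? []       u w = (u Fin.≟ w) ⊎-dec R? u w
    via? (v ∷ vs) u w = via? vs u w ⊎-dec (via? vs u v ×-dec via? vs v w)

    via⇒star : ∀ vs {u w} → Via vs u w → Star R u w
    via⇒star []       (inj₁ refl)    = ε
    via⇒star []       (inj₂ r)       = r ◅ ε
    via⇒star (v ∷ vs) (inj₁ p)       = via⇒star vs p
    via⇒star (v ∷ vs) (inj₂ (p , q)) = via⇒star vs p ◅◅ via⇒star vs q

    short : ∀ vs {u w} → u ≡ w ⊎ R u w → Via vs u w
    short []       p = p
    short (v ∷ vs) p = inj₁ (short vs p)

    join : ∀ {vs v u w} → v ∈ vs → Via vs u v → Via vs v w → Via vs u w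
    join (here refl) p q = inj₂ (to p , from q)
      where
      to : ∀ {vs v u} → Via (v ∷ vs) u v → Via vs u v
      to (inj₁ p)       = p
      to (inj₂ (p , _)) = p
      from : ∀ {vs v w} → Via (v ∷ vs) v w → Via vs v w
      from (inj₁ q)       = q
      from (inj₂ (_ , q)) = q
    join (there i) (inj₁ p)       (inj₁ q)       = inj₁ (join i p q)
    join (there i) (inj₁ p)       (inj₂ (q , r)) = inj₂ (join i p q , r)
    join (there i) (inj₂ (p , q)) (inj₁ r)       = inj₂ (p , join i q r)
    join (there i) (inj₂ (p , _)) (inj₂ (_ , r)) = inj₂ (p , r)

    star⇒via : ∀ {u w} → Star R u w → Via (allFin n) u w
    star⇒via ε        = short (allFin n) (inj₁ refl)
    star⇒via (r ◅ rs) = join (∈-allFin _) (short (allFin n) (inj₂ r)) (star⇒via rs)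

star? : {R : Rel (Fin n) ℓ} → Decidable R → Decidable (Star R)
star? {n = n} R? u w = map′ (via⇒star (allFin n)) star⇒via (via? (allFin n) u w)
  where open Reachability R?

eqClosure? : {R : Rel (Fin n) ℓ} → Decidable R → Decidable (EqClosure R)
eqClosure? {R = R} R? = star? sym?
  where
  sym? : Decidable (SymClosure R)
  sym? u w = map′ (λ { (inj₁ r) → fwd r ; (inj₂ r) → bwd r })
                  (λ { (fwd r) → inj₁ r ; (bwd r) → inj₂ r })
                  (R? u w ⊎-dec R? w u)

------------------------------------------------------------------------
-- Partial maps between finite sets

PartialMap : ℕ → ℕ → Set
PartialMap m n = Vec (Maybe (Fin n)) m

-- f maps v to w; read as a digraph, v → w is an arc of f.
Maps : PartialMap m n → Fin m → Fin n → Set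
Maps f v w = lookup f v ≡ just w

maps? : (f : PartialMap m n) → ∀ v w → Dec (Maps f v w)
maps? f v w = Maybe.≡-dec Fin._≟_ (lookup f v) (just w)

Injective : PartialMap m n → Set
Injective f = ∀ u v w → Maps f u w → Maps f v w → u ≡ v

injective? : U.Decidable (Injective {m} {n})
injective? f = Fin.all? λ u → Fin.all? λ v → Fin.all? λ w →
  maps? f u w →-dec (maps? f v w →-dec (u Fin.≟ v))

Image : PartialMap m n → Fin n → Set
Image f w = ∃[ v ] Maps f v w

image? : (f : PartialMap m n) → U.Decidable (Image f)
image? f w = Fin.any? λ v → maps? f v w

-- Weak connectivity. When f is a permutation the classes are its cycles.
Connected : PartialMap n n → Rel (Fin n) 0ℓ
Connected f = EqClosure (Maps f)

connected? : (f : PartialMap n n) → Decidable (Connected f)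
connected? f = eqClosure? (maps? f)

component : PartialMap n n → Fin n → List (Fin n)
component {n} f v = filter (connected? f v) (allFin n)

-- Components are counted through their least vertices.
Least : PartialMap n n → Fin n → Set
Least f v = ∀ w → Connected f v w → v ≤ w

least? : (f : PartialMap n n) → U.Decidable (Least f)
least? f v = Fin.all? λ w → connected? f v w →-dec (v Fin.≤? w)

evenCycles : PartialMap n n → ℕ
evenCycles f = count λ v → least? f v ×-dec (2 ∣? length (component f v))

-- A pair [u,w] is encoded as the partial injection u_i ↦ w_i, with
-- domain U and image W; each triple (U, W, bijection) is one such map.
pairs : (n : ℕ) → List (PartialMap n n)
pairs n = filter injective? (vectorsOver (allMaybe (allFin n)) n)

monomialOf : PartialMap n n → RawRing.Carrier (MatrixPolyRing n)
monomialOf {n} φ = prodOver (MatrixPolyRing n) (allFin n) λ u →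
  maybe (x u) (RawRing.1# (MatrixPolyRing n)) (lookup φ u)

------------------------------------------------------------------------
-- Oriented hypergraphs

record OrientedHypergraph : Set where
  field
    ∣V∣ ∣E∣ ∣I∣ : ℕ

  V = Fin ∣V∣
  E = Fin ∣E∣
  I = Fin ∣I∣

  field
    ς : I → V
    ω : I → E
    σ : I → Sign

  σℤ : I → ℤ
  σℤ i = σ i ◃ 1

  H : V → E → ℤ
  H v e = sumOver ℤ.+-*-rawRing
    (filter (λ i → (ς i Fin.≟ v) ×-dec (ω i Fin.≟ e)) (allFin ∣I∣)) σℤ

  laplacian : V → V → ℤ
  laplacian v w = sumOver ℤ.+-*-rawRing (allFin ∣E∣) λ e → H v e ℤ.* H w e

  -- The entry (i , j) at v is the step (v , i , ω i , j , ς j).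
  Family : Set
  Family = Vec (Maybe (I × I)) ∣V∣

  permOf : Family → PartialMap ∣V∣ ∣V∣
  permOf = Vec.map (Maybe.map (ς ∘ proj₂))

  edgesOf : Family → PartialMap ∣V∣ ∣E∣
  edgesOf = Vec.map (Maybe.map (ω ∘ proj₁))

  IsStep : V → I × I → Set
  IsStep v (i , j) = ς i ≡ v × ω i ≡ ω j

  isStep? : ∀ v → U.Decidable (IsStep v)
  isStep? v (i , j) = (ς i Fin.≟ v) ×-dec (ω i Fin.≟ ω j)

  record IsReducedContributor (φ : PartialMap ∣V∣ ∣V∣) (c : Family) : Set where
    field
      domain    : ∀ v → is-just (lookup c v) ≡ is-nothing (lookup φ v)
      steps     : ∀ v → All (IsStep v) (lookup c v)
      injective : Injective (permOf c)
      image⊆    : ∀ w → Image (permOf c) w → ¬ Image φ w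
      image⊇    : ∀ w → ¬ Image φ w → Image (permOf c) w

  isReducedContributor? : ∀ φ → U.Decidable (IsReducedContributor φ)
  isReducedContributor? φ c = map′
    (λ (d , s , i , p , q) → record
      { domain = d ; steps = s ; injective = i ; image⊆ = p ; image⊇ = q })
    (λ r → let open IsReducedContributor r in domain , steps , injective , image⊆ , image⊇)
    (Fin.all? (λ v → is-just (lookup c v) Bool.≟ is-nothing (lookup φ v))
     ×-dec Fin.all? (λ v → All.dec (isStep? v) (lookup c v))
     ×-dec injective? (permOf c)
     ×-dec Fin.all? (λ w → image? (permOf c) w →-dec ¬? (image? φ w))
     ×-dec Fin.all? (λ w → ¬? (image? φ w) →-dec image? (permOf c) w))

  reducedContributors : PartialMap ∣V∣ ∣V∣ → List Family
  reducedContributors φ = filter (isReducedContributor? φ)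
    (vectorsOver (allMaybe (cartesianProduct (allFin ∣I∣) (allFin ∣I∣))) ∣V∣)

  EdgeMonic : Family → Set
  EdgeMonic c = Injective (edgesOf c)

  edgeMonicContributors : PartialMap ∣V∣ ∣V∣ → List Family
  edgeMonicContributors φ = filter (injective? ∘ edgesOf) (reducedContributors φ)

  Backstep : Family → V → Set
  Backstep c v = ∃[ i ] lookup c v ≡ just (i , i)

  backstep? : ∀ c → U.Decidable (Backstep c)
  backstep? c v = Fin.any? λ i →
    Maybe.≡-dec (Product.≡-dec Fin._≟_ Fin._≟_) (lookup c v) (just (i , i))

  backsteps : Family → ℕ
  backsteps c = count (backstep? c)

  stepsInComponent : Family → V → List (I × I)
  stepsInComponent c v = mapMaybe (lookup c) (component (permOf c) v)

  componentSign : Family → V → ℤ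
  componentSign c v =
    -1ℤ ℤ.^ length (stepsInComponent c v)
    ℤ.* prodOver ℤ.+-*-rawRing (stepsInComponent c v) λ (i , j) → σℤ i ℤ.* σℤ j

  -- A backstep at v satisfies ς j = ς i = v, so it is a whole component and
  -- a component is a backstep iff its least vertex carries one.
  NegativeComponent : Family → V → Set
  NegativeComponent c v = Least (permOf c) v × ¬ Backstep c v × componentSign c v ≡ -1ℤ

  negativeComponent? : ∀ c → U.Decidable (NegativeComponent c)
  negativeComponent? c v =
    least? (permOf c) v ×-dec ¬? (backstep? c v) ×-dec (componentSign c v ℤ.≟ -1ℤ)

  negativeComponents : Family → ℕ
  negativeComponents c = count (negativeComponent? c)

  -- φ is defined exactly where c has no step, so the union is a permutation of V.
  extension : PartialMap ∣V∣ ∣V∣ → Family → PartialMap ∣V∣ ∣V∣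
  extension φ c = zipWith _<∣>_ (permOf c) φ

  csgn : PartialMap ∣V∣ ∣V∣ → Family → ℤ
  csgn φ c = -1ℤ ℤ.^ (evenCycles (extension φ c) ℕ.+ negativeComponents c ℕ.+ backsteps c)

module Submission where

-- Expanding every entry x_{v,w} - L_{v,w} of det(X - L), with L_{v,w} = Σ σ(i)σ(j)
-- over the steps (v, i, e, j, w), turns the determinant into a sum over triples
-- (φ, c, π): φ records where the indeterminate was chosen, c the step chosen
-- elsewhere, and π is the permutation that φ and c determine together.  The
-- weight is sgn(π) Π (-σ(i_v)σ(j_v)) times the monomial of φ.  Exchanging the
-- second incidences of two steps on a common edge composes π with a transposition
-- and preserves everything else, so only the edge-monic c survive.
-- Finally sgn(π) = (-1)^ec, and grouping the factors -σ(i_v)σ(j_v) by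
-- components gives (-1)^(nc+bs).

open import Algebra.Bundles using (CommutativeMonoid; CommutativeSemiring)
open import Algebra.Bundles.Raw using (RawRing)
open import Algebra.Morphism.Structures using (IsSemiringHomomorphism)
open import Algebra.Structures.Biased using (isCommutativeSemiringˡ; isCommutativeMonoidˡ)
open import Data.Bool.Base using (Bool; true; false; if_then_else_)
open import Data.Bool.Properties using (if-float)
open import Data.Empty using (⊥)
open import Data.Fin.Base as Fin using (Fin; zero; suc; _≤_; punchOut)
open import Data.Fin.Permutation.Components using (transpose; transpose-inverse)
import Data.Fin.Properties as Fin
import Data.Integer.Base as ℤ
open import Data.Integer.Base using (ℤ; 0ℤ; 1ℤ; -1ℤ; _◃_; _+_; -_; _^_)
import Data.Integer.Properties as ℤ
open import Data.Integer.Tactic.RingSolver using (solve-∀)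
open import Data.List.Base
  using (List; []; _∷_; _++_; map; foldr; filter; length; mapMaybe; deduplicate; allFin; cartesianProduct; cartesianProductWith)
open import Data.List.Membership.Propositional using (_∈_)
open import Data.List.Membership.Propositional.Properties
  using (∈-allFin; ∈-map⁺; ∈-map⁻; ∈-++⁺ˡ; ∈-++⁺ʳ; ∈-cartesianProduct⁺; ∈-cartesianProductWith⁺; ∈-deduplicate⁺)
import Data.List.Properties as List
open import Data.List.Relation.Unary.All as ListAll using ()
open import Data.List.Relation.Unary.AllPairs using ([]; _∷_)
open import Data.List.Relation.Unary.Any using (here; there)
open import Data.List.Relation.Unary.Unique.DecPropositional.Properties using (deduplicate-!)
open import Data.List.Relation.Unary.Unique.Propositional using (Unique)
import Data.List.Relation.Unary.Unique.Propositional.Properties as Unique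
open import Data.Maybe.Base as Maybe using (Maybe; just; nothing; maybe; is-just; is-nothing; _<∣>_)
open import Data.Maybe.Properties as Maybe using (just-injective)
open import Data.Maybe.Relation.Unary.All using (All; just; nothing)
open import Data.Nat.Base as ℕ using (ℕ; zero; suc; z≤n; s≤s)
open import Data.Nat.Divisibility using (_∣?_; ∣m∣n⇒∣m+n; ∣m+n∣m⇒∣n; ∣-refl)
import Data.Nat.Properties as ℕ
open import Data.Product.Base using (∃-syntax; _×_; _,_; proj₁; proj₂)
import Data.Product.Properties as Product
open import Data.Sign.Base as Sign using (Sign; opposite) renaming (_*_ to _·_)
import Data.Sign.Properties as Sign
open import Data.Sum.Base using (_⊎_; inj₁; inj₂; [_,_]′)
open import Data.Unit.Base using (tt)
open import Data.Vec.Base as Vec using (Vec; []; _∷_; lookup; tabulate; replicate; zipWith)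
open import Data.Vec.Functional using () renaming (_∷_ to _▹_)
import Data.Vec.Properties as Vec
open import Function.Base using (_∘_; id)
open import Function.Bundles using (_⇔_; mk⇔)
open import Function.Definitions using () renaming (Injective to Inj)
open import Level using (Level; 0ℓ)
import Relation.Binary.Construct.Closure.Equivalence as EqClosure
open import Relation.Binary.Construct.Closure.ReflexiveTransitive as Star using (_◅_)
open import Relation.Binary.Construct.Closure.Symmetric using (fwd; bwd)
open import Relation.Binary.Core using (Rel)
open import Relation.Binary.Definitions using (DecidableEquality; tri<; tri≈; tri>)
open import Relation.Binary.PropositionalEquality
  using (_≡_; _≢_; _≗_; refl; sym; trans; cong; cong₂; subst; subst₂; isEquivalence; module ≡-Reasoning)
open import Relation.Binary.Structures using (IsDecEquivalence; IsEquivalence)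
open import Relation.Nullary using (Dec; yes; no; does; ¬_; ¬?; contradiction)
open import Relation.Nullary.Decidable using (does-⇔; dec-true; dec-false; _×-dec_; _→-dec_)
import Relation.Unary as U
open import Algebra.Properties.CommutativeSemigroup Sign.*-commutativeSemigroup
  using () renaming (interchange to ·-interchange)
open import Defs

-- Being a contributor is a global condition: `φ` and the map of `c` must be injective with
-- complementary images. The expansion never imposes it. Instead `φ` and `c` range over all partial
-- choices, each pair carries a sum over all `π`, and the cancellation acts on these sums. The
-- exchange of second incidences then negates the sum whether or not any `π` fits, and a family that
-- the exchange fixes has a sum equal to its own negative, hence 0. The contributor condition
-- reappears on evaluation: at most one `π` fits a given pair, and it exists and is a permutation
-- exactly for an injective `φ` and a reduced contributor `c`.
--
-- The two sides also measure sgn(π) differently: the determinant counts inversions, the contributor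
-- sign counts even cycles through least vertices of connectivity classes. A cycle of length k
-- should contribute (-1)^(k+1), that is, one -1 for the cycle and one for each of its vertices.
-- Both descriptions are compared by induction, deleting the vertex 0 from its cycle.

private
  variable
    a b p q : Level
    A B : Set a
    P : Set p
    Q : Set q
    m n : ℕ

-- Finite sums in commutative monoids

-- Every element occurs exactly once, so a sum over `xs` is a sum over the type and can be reindexed
-- along any bijection of it.
record Enumerates {B : Set b} (xs : List B) : Set b where
  constructor _,_
  field
    unique   : Unique xs
    complete : ∀ a → a ∈ xs

open Enumerates

allFin-enumerates : ∀ n → Enumerates (allFin n)
allFin-enumerates n = Unique.allFin⁺ n , ∈-allFin

allMaybe-enumerates : {xs : List B} → Enumerates xs → Enumerates (allMaybe xs)
allMaybe-enumerates {xs = xs} e .unique =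
  ListAll.tabulate nothing∉ ∷ Unique.map⁺ just-injective (e .unique)
  where
  nothing∉ : ∀ {m} → m ∈ map just xs → nothing ≢ m
  nothing∉ m∈ refl with () ← proj₂ (proj₂ (∈-map⁻ just m∈))
allMaybe-enumerates e .complete nothing  = here refl
allMaybe-enumerates e .complete (just a) = there (∈-map⁺ just (e .complete a))

cartesianProduct-enumerates : {xs : List A} {ys : List B} →
  Enumerates xs → Enumerates ys → Enumerates (cartesianProduct xs ys)
cartesianProduct-enumerates d e .unique = Unique.cartesianProduct⁺ (d .unique) (e .unique)
cartesianProduct-enumerates d e .complete (a , b) =
  ∈-cartesianProduct⁺ (d .complete a) (e .complete b)

vectorsOver-enumerates : {xs : List B} → Enumerates xs → ∀ n → Enumerates (vectorsOver xs n)
vectorsOver-enumerates e zero .unique = ListAll.[] ∷ []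
vectorsOver-enumerates e zero .complete [] = here refl
vectorsOver-enumerates e (suc n) .unique = Unique.cartesianProductWith⁺ _∷_
  (λ where refl → refl , refl) (e .unique) (vectorsOver-enumerates e n .unique)
vectorsOver-enumerates e (suc n) .complete (a ∷ v) =
  ∈-cartesianProductWith⁺ _∷_ (e .complete a) (vectorsOver-enumerates e n .complete v)

module BigOperator {c ℓ} (M : CommutativeMonoid c ℓ) where
  open CommutativeMonoid M renaming (refl to ≈-refl; sym to ≈-sym; trans to ≈-trans)
  open import Algebra.Properties.CommutativeSemigroup commutativeSemigroup using (interchange)
  open import Relation.Binary.Reasoning.Setoid setoid

  big : List B → (B → Carrier) → Carrier
  big xs f = foldr _∙_ ε (map f xs)

  -- Conditions are attached to the terms instead of filtering the list: the index set stays fixed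
  -- while sums are exchanged, expanded and reindexed. Only `does d` enters, so equivalent decisions
  -- give equal values.
  when : Dec P → Carrier → Carrier
  when d t = if does d then t else ε

  when-yes : (d : Dec P) {t : Carrier} → P → when d t ≡ t
  when-yes d x rewrite dec-true d x = refl

  when-no : (d : Dec P) {t : Carrier} → ¬ P → when d t ≡ ε
  when-no d ¬x rewrite dec-false d ¬x = refl

  when-cong : (d : Dec P) {s t : Carrier} → (P → s ≈ t) → when d s ≈ when d t
  when-cong (yes x) s≈t = s≈t x
  when-cong (no _)  s≈t = ≈-refl

  when-⇔ : P ⇔ Q → (d : Dec P) (e : Dec Q) {t : Carrier} → when d t ≡ when e t
  when-⇔ P⇔Q d e {t} = cong (if_then t else ε) (does-⇔ P⇔Q d e)

  when-× : (d : Dec P) (e : Dec Q) {t : Carrier} → when (d ×-dec e) t ≡ when d (when e t)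
  when-× (yes _) e = refl
  when-× (no _)  e = refl

  when-ε : (d : Dec P) → when d ε ≈ ε
  when-ε (yes _) = ≈-refl
  when-ε (no _)  = ≈-refl

  when-∙ : (d : Dec P) {s t : Carrier} → when d (s ∙ t) ≈ when d s ∙ when d t
  when-∙ (yes _) = ≈-refl
  when-∙ (no _)  = ≈-sym (identityˡ ε)

  when-split : (d : Dec P) (e : Dec Q) {t : Carrier} →
               when d t ≈ when (d ×-dec e) t ∙ when (d ×-dec ¬? e) t
  when-split (yes _) (yes _) {t} = ≈-sym (identityʳ t)
  when-split (yes _) (no _)  {t} = ≈-sym (identityˡ t)
  when-split (no _)  _       {t} = ≈-sym (identityˡ ε)

  big-cong : (xs : List B) {f g : B → Carrier} → (∀ a → f a ≈ g a) → big xs f ≈ big xs g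
  big-cong []       f≈g = ≈-refl
  big-cong (a ∷ xs) f≈g = ∙-cong (f≈g a) (big-cong xs f≈g)

  big-ε : (xs : List B) {f : B → Carrier} → (∀ {a} → a ∈ xs → f a ≈ ε) → big xs f ≈ ε
  big-ε []       f≈ε = ≈-refl
  big-ε (a ∷ xs) f≈ε =
    ≈-trans (∙-cong (f≈ε (here refl)) (big-ε xs (f≈ε ∘ there))) (identityˡ ε)

  big-∙ : (xs : List B) {f g : B → Carrier} →
          big xs (λ a → f a ∙ g a) ≈ big xs f ∙ big xs g
  big-∙ []       = ≈-sym (identityˡ ε)
  big-∙ (a ∷ xs) = ≈-trans (∙-congˡ (big-∙ xs)) (interchange _ _ _ _)

  big-swap : (xs : List A) (ys : List B) {f : A → B → Carrier} →
             big xs (λ a → big ys (f a)) ≈ big ys (λ b → big xs (λ a → f a b))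
  big-swap []       ys = ≈-sym (big-ε ys (λ _ → ≈-refl))
  big-swap (a ∷ xs) ys = ≈-trans (∙-congˡ (big-swap xs ys)) (≈-sym (big-∙ ys))

  big-++ : (xs ys : List B) {f : B → Carrier} → big (xs ++ ys) f ≈ big xs f ∙ big ys f
  big-++ []       ys = ≈-sym (identityˡ _)
  big-++ (a ∷ xs) ys = ≈-trans (∙-congˡ (big-++ xs ys)) (≈-sym (assoc _ _ _))

  big-map : (g : A → B) (xs : List A) {f : B → Carrier} → big (map g xs) f ≡ big xs (f ∘ g)
  big-map g []       = refl
  big-map g (a ∷ xs) = cong (_ ∙_) (big-map g xs)

  big-cartesianProductWith : {C : Set q} (g : A → B → C) (xs : List A) (ys : List B) {f : C → Carrier} →
    big (cartesianProductWith g xs ys) f ≈ big xs (λ a → big ys (λ b → f (g a b)))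
  big-cartesianProductWith g []       ys = ≈-refl
  big-cartesianProductWith g (a ∷ xs) ys = ≈-trans (big-++ (map (g a) ys) _)
    (∙-cong (reflexive (big-map (g a) ys)) (big-cartesianProductWith g xs ys))

  big-filter : {P : U.Pred B p} (P? : U.Decidable P) (xs : List B) {f : B → Carrier} →
               big (filter P? xs) f ≈ big xs (λ a → when (P? a) (f a))
  big-filter P? [] = ≈-refl
  big-filter P? (a ∷ xs) with does (P? a)
  ... | true  = ∙-congˡ (big-filter P? xs)
  ... | false = ≈-trans (big-filter P? xs) (≈-sym (identityˡ _))

  big-when : (d : Dec P) (xs : List B) {f : B → Carrier} →
             big xs (λ a → when d (f a)) ≈ when d (big xs f)
  big-when (yes _) xs = ≈-refl
  big-when (no _)  xs = big-ε xs (λ _ → ≈-refl)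

  big-suc : (f : Fin (suc n) → Carrier) →
            big (allFin (suc n)) f ≡ f zero ∙ big (allFin n) (f ∘ suc)
  big-suc f = cong (λ xs → f zero ∙ foldr _∙_ ε xs)
    (trans (List.map-tabulate suc f) (sym (List.map-tabulate id (f ∘ suc))))

  big-unique : {xs : List B} → Unique xs → ∀ {a} → a ∈ xs → {f : B → Carrier} →
               (∀ b → b ≢ a → f b ≈ ε) → big xs f ≈ f a
  big-unique (a≢ ∷ u) (here refl) off =
    ≈-trans (∙-congˡ (big-ε _ (λ b∈ → off _ (ListAll.lookup a≢ b∈ ∘ sym)))) (identityʳ _)
  big-unique (a≢ ∷ u) (there a∈) off =
    ≈-trans (∙-cong (off _ (ListAll.lookup a≢ a∈)) (big-unique u a∈ off)) (identityˡ _)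

  big-single : {xs : List B} → Enumerates xs → ∀ a → {f : B → Carrier} →
               (∀ b → b ≢ a → f b ≈ ε) → big xs f ≈ f a
  big-single e a = big-unique (e .unique) (e .complete a)

  -- Double counting on the graph of `g`: in the double sum of `when (b ≟ g a) (f b)`, row `a` has
  -- the single entry `b = g a` and column `b` the single entry `a = h b`.
  big-reindex : {xs : List B} → Enumerates xs → DecidableEquality B →
                (g h : B → B) → (∀ a → g (h a) ≡ a) → (∀ a → h (g a) ≡ a) →
                {f : B → Carrier} → big xs (f ∘ g) ≈ big xs f
  big-reindex {xs = xs} e _≟_ g h gh hg {f} = begin
    big xs (f ∘ g)                                      ≈⟨ big-cong xs (λ a → expand a) ⟨
    big xs (λ a → big xs (λ b → when (b ≟ g a) (f b)))  ≈⟨ big-swap xs xs ⟩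
    big xs (λ b → big xs (λ a → when (b ≟ g a) (f b)))  ≈⟨ big-cong xs (λ b → contract b) ⟩
    big xs f                                            ∎
    where
    expand : ∀ a → big xs (λ b → when (b ≟ g a) (f b)) ≈ f (g a)
    expand a = ≈-trans
      (big-single e (g a) (λ b b≢ → reflexive (when-no (b ≟ g a) b≢)))
      (reflexive (when-yes (g a ≟ g a) refl))
    contract : ∀ b → big xs (λ a → when (b ≟ g a) (f b)) ≈ f b
    contract b = ≈-trans
      (big-single e (h b) (λ a a≢ → reflexive
        (when-no (b ≟ g a) λ b≡ → a≢ (trans (sym (hg a)) (cong h (sym b≡))))))
      (reflexive (when-yes (b ≟ g (h b)) (sym (gh b))))

-- Equivalence classes and their least elements

least-satisfying : {P : U.Pred (Fin n) p} → U.Decidable P → ∀ w → P w →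
                   ∃[ v ] P v × (∀ u → P u → v ≤ u)
least-satisfying {n = suc n} P? w Pw with P? zero
... | yes P0 = zero , P0 , λ _ _ → z≤n
least-satisfying {n = suc n} P? zero    Pw | no ¬P0 = contradiction Pw ¬P0
least-satisfying {n = suc n} P? (suc w) Pw | no ¬P0
  with v , Pv , v≤ ← least-satisfying (P? ∘ suc) w Pw = suc v , Pv , λ where
    zero    P0 → contradiction P0 ¬P0
    (suc u) Pu → s≤s (v≤ u Pu)

module Classes {_~_ : Rel (Fin n) 0ℓ} (isDecEquivalence : IsDecEquivalence _~_) where
  open IsDecEquivalence isDecEquivalence using ()
    renaming (refl to ~-refl; sym to ~-sym; trans to ~-trans; _≟_ to _~?_)

  LeastInClass : Fin n → Set
  LeastInClass v = ∀ w → v ~ w → v ≤ w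

  leastInClass? : U.Decidable LeastInClass
  leastInClass? v = Fin.all? λ w → (v ~? w) →-dec (v Fin.≤? w)

  leastInClass-exists : ∀ w → ∃[ v ] LeastInClass v × v ~ w
  leastInClass-exists w
    with v , v~w , v≤ ← least-satisfying (_~? w) w ~-refl =
    v , (λ u v~u → v≤ u (~-trans (~-sym v~u) v~w)) , v~w

  leastInClass-unique : ∀ {u v} → LeastInClass u → LeastInClass v → u ~ v → u ≡ v
  leastInClass-unique lu lv u~v = Fin.≤-antisym (lu _ u~v) (lv _ (~-sym u~v))

  module _ {c ℓ} (M : CommutativeMonoid c ℓ) where
    open CommutativeMonoid M using (Carrier; _≈_; setoid; reflexive)
    open BigOperator M
    open import Relation.Binary.Reasoning.Setoid setoid

    -- Exactly one index survives, the least element of the class of `w`. Read from right to left,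
    -- this lets a single term be spread over all vertices.
    big-leastInClass : ∀ w {t} →
      big (allFin n) (λ v → when (leastInClass? v ×-dec (v ~? w)) t) ≈ t
    big-leastInClass w {t} with v , lv , v~w ← leastInClass-exists w = begin
      big (allFin n) (λ u → when (leastInClass? u ×-dec (u ~? w)) t)
        ≈⟨ big-single (allFin-enumerates n) v (λ u u≢v →
             reflexive (when-no (leastInClass? u ×-dec (u ~? w)) λ (lu , u~w) →
               u≢v (leastInClass-unique lu lv (~-trans u~w (~-sym v~w))))) ⟩
      when (leastInClass? v ×-dec (v ~? w)) t
        ≡⟨ when-yes (leastInClass? v ×-dec (v ~? w)) (lv , v~w) ⟩
      t ∎

    -- After the exchange of the two sums, `f w` is weighted by the number of least elements in the
    -- class of `w`, which is one.
    big-partition : (f : Fin n → Carrier) →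
      big (allFin n) (λ v → when (leastInClass? v) (big (filter (v ~?_) (allFin n)) f))
        ≈ big (allFin n) f
    big-partition f = begin
      big Vs (λ v → when (leastInClass? v) (big (filter (v ~?_) Vs) f))
        ≈⟨ big-cong Vs (λ v → when-cong (leastInClass? v) (λ _ → big-filter (v ~?_) Vs)) ⟩
      big Vs (λ v → when (leastInClass? v) (big Vs λ w → when (v ~? w) (f w)))
        ≈⟨ big-cong Vs (λ v → big-when (leastInClass? v) Vs) ⟨
      big Vs (λ v → big Vs λ w → when (leastInClass? v) (when (v ~? w) (f w)))
        ≈⟨ big-cong Vs (λ v → big-cong Vs (λ w →
             reflexive (when-× (leastInClass? v) (v ~? w)))) ⟨
      big Vs (λ v → big Vs λ w → when (leastInClass? v ×-dec (v ~? w)) (f w))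
        ≈⟨ big-swap Vs Vs ⟩
      big Vs (λ w → big Vs λ v → when (leastInClass? v ×-dec (v ~? w)) (f w))
        ≈⟨ big-cong Vs (λ w → big-leastInClass w) ⟩
      big Vs f ∎
      where Vs = allFin n

-- Transpositions

-- A relation instead of a composition with `transpose`: it passes to tails and to composites field
-- by field, and it applies equally to permutations and to sign-valued functions of the vertices.
record Swapped {A : Set a} (i j : Fin n) (f g : Fin n → A) : Set a where
  field
    at₁ : g i ≡ f j
    at₂ : g j ≡ f i
    off : ∀ {k} → k ≢ i → k ≢ j → g k ≡ f k

open Swapped

swapped-sym : {i j : Fin n} {f g : Fin n → A} → Swapped i j f g → Swapped j i f g
swapped-sym s .at₁ = s .at₂
swapped-sym s .at₂ = s .at₁
swapped-sym s .off k≢j k≢i = s .off k≢i k≢j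

swapped-∘ : {i j : Fin n} {f g : Fin n → A} (h : A → B) →
            Swapped i j f g → Swapped i j (h ∘ f) (h ∘ g)
swapped-∘ h s .at₁ = cong h (s .at₁)
swapped-∘ h s .at₂ = cong h (s .at₂)
swapped-∘ h s .off k≢i k≢j = cong h (s .off k≢i k≢j)

swapped-suc : {i j : Fin n} {f g : Fin (suc n) → A} →
              Swapped (suc i) (suc j) f g → Swapped i j (f ∘ suc) (g ∘ suc)
swapped-suc s .at₁ = s .at₁
swapped-suc s .at₂ = s .at₂
swapped-suc s .off k≢i k≢j = s .off (k≢i ∘ Fin.suc-injective) (k≢j ∘ Fin.suc-injective)

swapped-transpose : (i j : Fin n) (f : Fin n → A) → Swapped i j f (f ∘ transpose i j)
swapped-transpose i j f .at₁ with i Fin.≟ i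
... | yes _  = refl
... | no i≢i = contradiction refl i≢i
swapped-transpose i j f .at₂ with j Fin.≟ i
... | yes j≡i = cong f j≡i
... | no _ with j Fin.≟ j
...   | yes _  = refl
...   | no j≢j = contradiction refl j≢j
swapped-transpose i j f .off {k} k≢i k≢j with k Fin.≟ i
... | yes k≡i = contradiction k≡i k≢i
... | no _ with k Fin.≟ j
...   | yes k≡j = contradiction k≡j k≢j
...   | no _    = refl

swapped-functional : {i j : Fin n} {f g h : Fin n → A} →
                     Swapped i j f g → Swapped i j f h → g ≗ h
swapped-functional {i = i} {j} s t k with k Fin.≟ i
... | yes refl = trans (s .at₁) (sym (t .at₁))
... | no k≢i with k Fin.≟ j
...   | yes refl = trans (s .at₂) (sym (t .at₂))
...   | no k≢j   = trans (s .off k≢i k≢j) (sym (t .off k≢i k≢j))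

swapped-injective : {i j : Fin n} {f g : Fin n → A} →
                    Inj _≡_ _≡_ f → Swapped i j f g → Inj _≡_ _≡_ g
swapped-injective {i = i} {j} {f} inj s {u} {v} gu≡gv = trans (sym (transpose-inverse j i))
  (trans (cong (transpose j i) (inj (trans (sym (g≗ u)) (trans gu≡gv (g≗ v)))))
         (transpose-inverse j i))
  where g≗ = swapped-functional s (swapped-transpose i j f)

module _ {c ℓ} (M : CommutativeMonoid c ℓ) where
  open CommutativeMonoid M using (Carrier; _≈_; reflexive) renaming (trans to ≈-trans)
  open BigOperator M

  big-swapped : {i j : Fin n} {f g : Fin n → Carrier} →
                Swapped i j f g → big (allFin n) g ≈ big (allFin n) f
  big-swapped {n = n} {i = i} {j} {f} s = ≈-trans
    (big-cong (allFin n) (λ v → reflexive (swapped-functional s (swapped-transpose i j f) v)))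
    (big-reindex (allFin-enumerates n) Fin._≟_ (transpose i j) (transpose j i)
      (λ _ → transpose-inverse i j) (λ _ → transpose-inverse j i))

-- Signs of injections between finite ordinals

module Π = BigOperator Sign.*-commutativeMonoid

toℤ : Sign → ℤ
toℤ s = s ◃ 1

toℤ-* : ∀ s t → toℤ (s · t) ≡ toℤ s ℤ.* toℤ t
toℤ-* Sign.+ t = sym (ℤ.*-identityˡ (toℤ t))
toℤ-* Sign.- Sign.+ = refl
toℤ-* Sign.- Sign.- = refl

toℤ-opposite : ∀ s → toℤ (opposite s) ≡ - toℤ s
toℤ-opposite Sign.+ = refl
toℤ-opposite Sign.- = refl

opposite-·ˡ : ∀ s t → opposite s · t ≡ opposite (s · t)
opposite-·ˡ Sign.+ t = refl
opposite-·ˡ Sign.- t = sym (Sign.opposite-involutive t)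

opposite-·ʳ : ∀ s t → s · opposite t ≡ opposite (s · t)
opposite-·ʳ Sign.+ t = refl
opposite-·ʳ Sign.- t = refl

alternating : ℕ → Sign
alternating zero    = Sign.+
alternating (suc k) = opposite (alternating k)

^-alternating : ∀ k → -1ℤ ^ k ≡ toℤ (alternating k)
^-alternating zero    = refl
^-alternating (suc k) = trans (cong (-1ℤ ℤ.*_) (^-alternating k)) (sym (toℤ-* Sign.- (alternating k)))

alternating-length : (xs : List A) → alternating (length xs) ≡ Π.big xs (λ _ → Sign.-)
alternating-length []       = refl
alternating-length (_ ∷ xs) = cong opposite (alternating-length xs)

alternating-filter : {P : U.Pred A p} (P? : U.Decidable P) (xs : List A) →
  alternating (length (filter P? xs)) ≡ Π.big xs (λ v → Π.when (P? v) Sign.-)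
alternating-filter P? xs = trans (alternating-length (filter P? xs)) (Π.big-filter P? xs)

alternating-parity : ∀ k → (if does (2 ∣? k) then Sign.+ else Sign.-) ≡ alternating k
alternating-parity zero          = refl
alternating-parity (suc zero)    = refl
alternating-parity (suc (suc k)) = begin
  (if does (2 ∣? 2 ℕ.+ k) then Sign.+ else Sign.-)
    ≡⟨ cong (if_then Sign.+ else Sign.-) (does-⇔
         (mk⇔ (λ d → ∣m+n∣m⇒∣n d ∣-refl) (∣m∣n⇒∣m+n ∣-refl)) (2 ∣? 2 ℕ.+ k) (2 ∣? k)) ⟩
  (if does (2 ∣? k) then Sign.+ else Sign.-) ≡⟨ alternating-parity k ⟩
  alternating k                              ≡⟨ Sign.opposite-involutive (alternating k) ⟨
  alternating (2 ℕ.+ k)                      ∎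
  where open ≡-Reasoning

smallerSign : Fin m → (Fin n → Fin m) → Sign
smallerSign {n = n} c f = Π.big (allFin n) λ v → Π.when (f v Fin.<? c) Sign.-

-- The inversions are grouped by their left position. Domain and codomain are independent because
-- the recursion drops the first position only: the tail of a permutation is an injection into the
-- same codomain.
sgn : (Fin n → Fin m) → Sign
sgn {zero}  f = Sign.+
sgn {suc n} f = smallerSign (f zero) (f ∘ suc) · sgn (f ∘ suc)

inversionSign : (Fin n → Fin m) → Sign
inversionSign {n} f = Π.big (allFin n) λ u → Π.big (allFin n) λ v →
  Π.when ((u Fin.<? v) ×-dec (f v Fin.<? f u)) Sign.-

inversionSign≡sgn : (f : Fin n → Fin m) → inversionSign f ≡ sgn f
inversionSign≡sgn {zero}  f = refl
inversionSign≡sgn {suc n} f = trans (Π.big-suc λ u → Π.big (allFin (suc n)) (term u))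
  -- `term zero zero` and every `term (suc u) zero` compute to `+`, as nothing lies below `zero`, so
  -- these leading factors disappear by reduction.
  (cong₂ _·_ (Π.big-suc (term zero))
    (trans (Π.big-cong (allFin n) (λ u → Π.big-suc (term (suc u))))
           (inversionSign≡sgn (f ∘ suc))))
  where
  term : Fin (suc n) → Fin (suc n) → Sign
  term u v = Π.when ((u Fin.<? v) ×-dec (f v Fin.<? f u)) Sign.-

alternating-inversions : (π : Vec (Fin n) n) → alternating (inversions π) ≡ sgn (lookup π)
alternating-inversions {n} π = trans (alternating-filter (inversion? π) (cartesianProduct (allFin n) (allFin n)))
  (trans (Π.big-cartesianProductWith _,_ (allFin n) (allFin n)) (inversionSign≡sgn (lookup π)))

smallerSign-cong : (c : Fin m) {f g : Fin n → Fin m} → f ≗ g → smallerSign c f ≡ smallerSign c g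
smallerSign-cong {n = n} c f≗g =
  Π.big-cong (allFin n) λ v → cong (λ d → Π.when (d Fin.<? c) Sign.-) (f≗g v)

sgn-cong : {f g : Fin n → Fin m} → f ≗ g → sgn f ≡ sgn g
sgn-cong {zero}  f≗g = refl
sgn-cong {suc n} {f = f} {g} f≗g rewrite f≗g zero =
  cong₂ _·_ (smallerSign-cong (g zero) (f≗g ∘ suc)) (sgn-cong (f≗g ∘ suc))

smallerSign-swapped : (c : Fin m) {i j : Fin n} {f g : Fin n → Fin m} →
                      Swapped i j f g → smallerSign c g ≡ smallerSign c f
smallerSign-swapped c s = big-swapped Sign.*-commutativeMonoid
  (swapped-∘ (λ d → Π.when (d Fin.<? c) Sign.-) s)

<-sign-antisym : {c d : Fin n} → c ≢ d → Π.when (c Fin.<? d) Sign.- ≡ opposite (Π.when (d Fin.<? c) Sign.-)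
<-sign-antisym {c = c} {d} c≢d with Fin.<-cmp c d
... | tri< c<d _ d≮c rewrite Π.when-yes (c Fin.<? d) {Sign.-} c<d | Π.when-no (d Fin.<? c) {Sign.-} d≮c = refl
... | tri≈ _ c≡d _ = contradiction c≡d c≢d
... | tri> c≮d _ d<c rewrite Π.when-no (c Fin.<? d) {Sign.-} c≮d | Π.when-yes (d Fin.<? c) {Sign.-} d<c = refl

tail₂ : (Fin (2 ℕ.+ n) → A) → Fin n → A
tail₂ f k = f (suc (suc k))

-- Only the comparison of the first two values with each other is reversed; their comparisons with
-- the tail merely trade places.
sgn-swapped-head : {f g : Fin (2 ℕ.+ n) → Fin m} → f zero ≢ f (suc zero) →
                   Swapped zero (suc zero) f g → sgn g ≡ opposite (sgn f)
sgn-swapped-head {f = f} {g} f0≢f1 s = begin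
  sgn g
    ≡⟨ cong₂ _·_ (trans (cong (λ c → smallerSign c (g ∘ suc)) (s .at₁)) expand₁)
         (cong₂ _·_ (trans (cong (λ c → smallerSign c (tail₂ g)) (s .at₂))
                           (smallerSign-cong f0 gss))
                    (sgn-cong gss)) ⟩
  (opposite e · smallerSign f1 fss) · (smallerSign f0 fss · sgn fss)
    ≡⟨ rearrange e (smallerSign f1 fss) (smallerSign f0 fss) (sgn fss) ⟩
  opposite ((e · smallerSign f0 fss) · (smallerSign f1 fss · sgn fss))
    ≡⟨ cong (λ z → opposite (z · (smallerSign f1 fss · sgn fss)))
         (Π.big-suc (λ v → Π.when (f (suc v) Fin.<? f0) Sign.-)) ⟨
  opposite (sgn f) ∎
  where
  open ≡-Reasoning
  f0 = f zero
  f1 = f (suc zero)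
  fss = tail₂ f
  e = Π.when (f1 Fin.<? f0) Sign.-
  gss : tail₂ g ≗ fss
  gss k = s .off (λ ()) (λ ())
  expand₁ : smallerSign f1 (g ∘ suc) ≡ opposite e · smallerSign f1 fss
  expand₁ = trans (Π.big-suc (λ v → Π.when (g (suc v) Fin.<? f1) Sign.-)) (cong₂ _·_
    (trans (cong (λ d → Π.when (d Fin.<? f1) Sign.-) (s .at₂)) (<-sign-antisym f0≢f1))
    (smallerSign-cong f1 gss))
  rearrange : ∀ e x y z → (opposite e · x) · (y · z) ≡ opposite ((e · y) · (x · z))
  rearrange e x y z = trans (cong (_· (y · z)) (opposite-·ˡ e x))
    (trans (opposite-·ˡ (e · x) (y · z)) (cong opposite (·-interchange e x y z)))

-- Conjugation by the exchange of 0 and 1 moves the transposition into the tail.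
sgn-swapped-zero : (j : Fin n) {f g : Fin (suc n) → Fin m} → Inj _≡_ _≡_ f →
                   Swapped zero (suc j) f g → sgn g ≡ opposite (sgn f)
sgn-swapped-zero zero inj s = sgn-swapped-head (Fin.0≢1+n ∘ inj) s
sgn-swapped-zero (suc j) {f} {g} inj s = begin
  sgn g                                   ≡⟨ sgn-swapped-head k0≢k1 (adjacent g) ⟩
  opposite (smallerSign g1 (k ∘ suc) · sgn (k ∘ suc))
    ≡⟨ cong opposite (cong₂ _·_
         (trans (cong (λ c → smallerSign c (k ∘ suc)) (s .off (λ ()) (λ ())))
                (smallerSign-swapped f1 t))
         (sgn-swapped-zero j h∘suc-inj t)) ⟩
  opposite (smallerSign f1 (h ∘ suc) · opposite (sgn (h ∘ suc)))  ≡⟨ neg (smallerSign f1 (h ∘ suc)) (sgn (h ∘ suc)) ⟩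
  sgn h                                   ≡⟨ sgn-swapped-head (Fin.0≢1+n ∘ inj) (adjacent′ f) ⟩
  opposite (sgn f) ∎
  where
  open ≡-Reasoning
  f1 = f (suc zero)
  g1 = g (suc zero)
  h = f1 ▹ f zero ▹ tail₂ f
  k = g1 ▹ g zero ▹ tail₂ g
  adjacent : (f : Fin (2 ℕ.+ n) → A) →
             Swapped zero (suc zero) (f (suc zero) ▹ f zero ▹ tail₂ f) f
  adjacent f .at₁ = refl
  adjacent f .at₂ = refl
  adjacent f .off {zero}        0≢0 _ = contradiction refl 0≢0
  adjacent f .off {suc zero}    _ 1≢1 = contradiction refl 1≢1
  adjacent f .off {suc (suc _)} _ _   = refl
  adjacent′ : (f : Fin (2 ℕ.+ n) → A) →
              Swapped zero (suc zero) f (f (suc zero) ▹ f zero ▹ tail₂ f)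
  adjacent′ f .at₁ = refl
  adjacent′ f .at₂ = refl
  adjacent′ f .off {zero}        0≢0 _ = contradiction refl 0≢0
  adjacent′ f .off {suc zero}    _ 1≢1 = contradiction refl 1≢1
  adjacent′ f .off {suc (suc _)} _ _   = refl
  t : Swapped zero (suc j) (h ∘ suc) (k ∘ suc)
  t .at₁ = s .at₁
  t .at₂ = s .at₂
  t .off {zero}  0≢0 _ = contradiction refl 0≢0
  t .off {suc _} _ k≢j = s .off (λ ()) (k≢j ∘ Fin.suc-injective)
  k0≢k1 : g1 ≢ g zero
  k0≢k1 g1≡g0 = Fin.0≢1+n (sym (swapped-injective inj s g1≡g0))
  h∘suc-inj : Inj _≡_ _≡_ (h ∘ suc)
  h∘suc-inj = Fin.suc-injective ∘ swapped-injective inj (adjacent′ f)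
  neg : ∀ x y → opposite (x · opposite y) ≡ x · y
  neg x y = trans (cong opposite (opposite-·ʳ x y)) (Sign.opposite-involutive (x · y))

sgn-swapped : {i j : Fin n} {f g : Fin n → Fin m} → i ≢ j → Inj _≡_ _≡_ f →
              Swapped i j f g → sgn g ≡ opposite (sgn f)
sgn-swapped {i = zero}  {zero}  i≢j inj s = contradiction refl i≢j
sgn-swapped {i = zero}  {suc j} i≢j inj s = sgn-swapped-zero j inj s
sgn-swapped {i = suc i} {zero}  i≢j inj s = sgn-swapped-zero i inj (swapped-sym s)
sgn-swapped {n = suc n} {i = suc i} {suc j} {f} {g} i≢j inj s = begin
  smallerSign (g zero) (g ∘ suc) · sgn (g ∘ suc)
    ≡⟨ cong₂ _·_ (trans (cong (λ c → smallerSign c (g ∘ suc)) (s .off (λ ()) (λ ())))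
                        (smallerSign-swapped (f zero) (swapped-suc s)))
                 (sgn-swapped (i≢j ∘ cong suc) (Fin.suc-injective ∘ inj) (swapped-suc s)) ⟩
  smallerSign (f zero) (f ∘ suc) · opposite (sgn (f ∘ suc))
    ≡⟨ opposite-·ʳ (smallerSign (f zero) (f ∘ suc)) (sgn (f ∘ suc)) ⟩
  opposite (sgn f) ∎
  where open ≡-Reasoning

-- Cycles and signs of permutations

connected-isDecEquivalence : (f : PartialMap n n) → IsDecEquivalence (Connected f)
connected-isDecEquivalence f = record
  { isEquivalence = EqClosure.isEquivalence (Maps f) ; _≟_ = connected? f }

module Components {n} (f : PartialMap n n) = Classes (connected-isDecEquivalence f)

componentsSign : PartialMap n n → Sign
componentsSign {n} f = Π.big (allFin n) λ v → Π.when (least? f v) Sign.-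

-- A class of k vertices has sign -1 on the left exactly when k is even, which is (-1)^(k+1) for
-- every k. The exponents k, collected over the classes, give one -1 for each vertex.
alternating-evenCycles : (f : PartialMap n n) →
  alternating (evenCycles f) ≡ componentsSign f · Π.big (allFin n) λ _ → Sign.-
alternating-evenCycles {n} f = begin
  alternating (evenCycles f)
    ≡⟨ alternating-filter (λ v → least? f v ×-dec (2 ∣? length (component f v))) (allFin n) ⟩
  Π.big (allFin n) (λ v → Π.when (least? f v ×-dec (2 ∣? length (component f v))) Sign.-)
    ≡⟨ Π.big-cong (allFin n) (λ v → trans (Π.when-× (least? f v) (2 ∣? length (component f v)))
         (Π.when-cong (least? f v) (λ _ → even-sign (component f v)))) ⟩
  Π.big (allFin n) (λ v → Π.when (least? f v) (Sign.- · Π.big (component f v) (λ _ → Sign.-)))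
    ≡⟨ Π.big-cong (allFin n) (λ v → Π.when-∙ (least? f v)) ⟩
  Π.big (allFin n) (λ v → Π.when (least? f v) Sign.- ·
                          Π.when (least? f v) (Π.big (component f v) (λ _ → Sign.-)))
    ≡⟨ Π.big-∙ (allFin n) ⟩
  componentsSign f · Π.big (allFin n) (λ v →
                       Π.when (least? f v) (Π.big (component f v) (λ _ → Sign.-)))
    ≡⟨ cong (componentsSign f ·_) (Components.big-partition f Sign.*-commutativeMonoid _) ⟩
  componentsSign f · Π.big (allFin n) (λ _ → Sign.-) ∎
  where
  open ≡-Reasoning
  even-sign : (xs : List A) →
              Π.when (2 ∣? length xs) Sign.- ≡ Sign.- · Π.big xs (λ _ → Sign.-)
  even-sign xs = begin
    Π.when (2 ∣? length xs) Sign.-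
      ≡⟨ if-float opposite (does (2 ∣? length xs)) ⟨
    opposite (if does (2 ∣? length xs) then Sign.+ else Sign.-)
      ≡⟨ cong opposite (alternating-parity (length xs)) ⟩
    opposite (alternating (length xs))
      ≡⟨ cong opposite (alternating-length xs) ⟩
    Sign.- · Π.big xs (λ _ → Sign.-) ∎

injective⇒surjective : {f : Fin n → Fin n} → Inj _≡_ _≡_ f → ∀ w → ∃[ v ] f v ≡ w
injective⇒surjective {n = suc n} {f} inj w with Fin.any? (λ v → f v Fin.≟ w)
... | yes found = found
... | no ¬found = contradiction
  (Fin.injective⇒≤ {f = λ v → punchOut (w≢ v)} (λ {u} {v} eq → inj (Fin.punchOut-injective (w≢ u) (w≢ v) eq)))
  ℕ.1+n≰n
  where
  w≢ : ∀ v → w ≢ f v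
  w≢ v w≡ = ¬found (v , sym w≡)

graph : (Fin n → Fin n) → PartialMap n n
graph π = Vec.tabulate (just ∘ π)

maps-graph : (π : Fin n → Fin n) → ∀ u → Maps (graph π) u (π u)
maps-graph π u = Vec.lookup∘tabulate (just ∘ π) u

maps-graph⁻ : (π : Fin n → Fin n) → ∀ u {v} → Maps (graph π) u v → π u ≡ v
maps-graph⁻ π u eq = just-injective (trans (sym (maps-graph π u)) eq)

connected-arc : (π : Fin n → Fin n) → ∀ {u v} → π u ≡ v → Connected (graph π) u v
connected-arc π {u} refl = EqClosure.return (maps-graph π u)

-- π′ is obtained from π by deleting 0 from its cycle.
Contracts : (Fin (suc n) → Fin (suc n)) → (Fin n → Fin n) → Set
Contracts π π′ = ∀ v → π (suc v) ≡ suc (π′ v) ⊎ (π (suc v) ≡ zero × π zero ≡ suc (π′ v))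

private
  from : Fin n → Fin (suc n) → Fin n
  from d zero    = d
  from d (suc v) = v

  zero∨suc : (i : Fin (suc n)) → i ≡ zero ⊎ ∃[ d ] i ≡ suc d
  zero∨suc zero    = inj₁ refl
  zero∨suc (suc d) = inj₂ (d , refl)

module Contraction {π : Fin (suc n) → Fin (suc n)} {π′ : Fin n → Fin n} (c : Contracts π π′) where

  private
    f  = graph π
    f′ = graph π′

  -- An arc of `π′` is either an arc of `π` or the shortcut of two consecutive arcs of `π` through
  -- 0.
  connected-suc : ∀ {u v} → Connected f′ u v → Connected f (suc u) (suc v)
  connected-suc = EqClosure.gfold (EqClosure.isEquivalence (Maps f)) suc arc
    where
    arc : ∀ {u v} → Maps f′ u v → Connected f (suc u) (suc v)
    arc {u} m with c u | maps-graph⁻ π′ u m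
    ... | inj₁ eq         | refl = connected-arc π eq
    ... | inj₂ (eq₁ , eq₂) | refl =
      EqClosure.transitive _ (connected-arc π eq₁) (connected-arc π eq₂)

  -- If 0 is a fixed point it is isolated, and d may be any vertex.
  connected-contract : ∀ d → π zero ≡ zero ⊎ π zero ≡ suc d →
                       ∀ {u v} → Connected f u v → Connected f′ (from d u) (from d v)
  connected-contract d eq₀ = EqClosure.gfold (EqClosure.isEquivalence (Maps f′)) (from d)
    λ {u} m → subst (λ v → Connected f′ (from d u) (from d v)) (maps-graph⁻ π u m) (arc eq₀ u)
    where
    arc : π zero ≡ zero ⊎ π zero ≡ suc d → ∀ u → Connected f′ (from d u) (from d (π u))
    arc (inj₁ eq) zero rewrite eq = EqClosure.reflexive _
    arc (inj₂ eq) zero rewrite eq = EqClosure.reflexive _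
    arc eq₀ (suc u) with c u
    arc _         (suc u) | inj₁ eq rewrite eq = connected-arc π′ refl
    arc (inj₁ eq) (suc u) | inj₂ (_ , eq₂) with () ← trans (sym eq) eq₂
    arc (inj₂ eq) (suc u) | inj₂ (eq₁ , eq₂) rewrite eq₁ =
      connected-arc π′ (Fin.suc-injective (trans (sym eq₂) eq))

  connected-suc⁻ : ∀ {u v} → Connected f (suc u) (suc v) → Connected f′ u v
  connected-suc⁻ {u} with zero∨suc (π zero)
  ... | inj₁ eq       = connected-contract u (inj₁ eq)
  ... | inj₂ (d , eq) = connected-contract d (inj₂ eq)

  -- The vertex 0 is a class by itself and the other classes keep their least vertices, so deleting
  -- 0 loses exactly one class.
  componentsSign-fixed : π zero ≡ zero → componentsSign f ≡ opposite (componentsSign f′)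
  componentsSign-fixed eq₀ = begin
    componentsSign f
      ≡⟨ Π.big-suc (λ v → Π.when (least? f v) Sign.-) ⟩
    Π.when (least? f zero) Sign.- · Π.big (allFin n) (λ v → Π.when (least? f (suc v)) Sign.-)
      ≡⟨ cong₂ _·_ (Π.when-yes (least? f zero) (λ _ _ → z≤n))
           (Π.big-cong (allFin n) (λ v → Π.when-⇔ (mk⇔ to from′) (least? f (suc v)) (least? f′ v))) ⟩
    opposite (componentsSign f′) ∎
    where
    open ≡-Reasoning
    -- Being 0 is invariant along arcs, hence along the whole equivalence closure; this separates 0
    -- from the other vertices.
    isZero : Fin (suc n) → Bool
    isZero zero    = true
    isZero (suc _) = false
    arc : ∀ {u v} → Maps f u v → isZero u ≡ isZero v
    arc {zero} m with refl ← trans (sym eq₀) (maps-graph⁻ π zero m) = refl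
    arc {suc u} m with c u | maps-graph⁻ π (suc u) m
    ... | inj₁ eq       | refl rewrite eq = refl
    ... | inj₂ (_ , eq) | _    with () ← trans (sym eq₀) eq
    isolated : ∀ {v} → ¬ Connected f (suc v) zero
    isolated p with () ← EqClosure.gfold isEquivalence isZero arc p
    to : ∀ {v} → Least f (suc v) → Least f′ v
    to l w p with s≤s v≤w ← l (suc w) (connected-suc p) = v≤w
    from′ : ∀ {v} → Least f′ v → Least f (suc v)
    from′ l zero    p = contradiction p isolated
    from′ l (suc w) p = s≤s (l w (connected-suc⁻ p))

  -- The number of classes is unchanged, but one representative moves: the class of 0 is represented
  -- by 0 before the deletion and by the least vertex of the class of `d` after it. The factor at
  -- `zero` is therefore rewritten as the contribution of the class of `d`, and the factors at
  -- `suc v` account for all other classes of `f′`.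
  componentsSign-moved : ∀ {d} → π zero ≡ suc d → componentsSign f ≡ componentsSign f′
  componentsSign-moved {d} eq₀ = begin
    componentsSign f
      ≡⟨ Π.big-suc (λ v → Π.when (least? f v) Sign.-) ⟩
    Π.when (least? f zero) Sign.- · Π.big (allFin n) (λ v → Π.when (least? f (suc v)) Sign.-)
      ≡⟨ cong₂ _·_
           (trans (Π.when-yes (least? f zero) (λ _ _ → z≤n))
                  (sym (Components.big-leastInClass f′ Sign.*-commutativeMonoid d)))
           (Π.big-cong (allFin n) (λ v → Π.when-⇔ (mk⇔ to from′) (least? f (suc v))
             (least? f′ v ×-dec ¬? (connected? f′ v d)))) ⟩
    Π.big (allFin n) (λ v → Π.when (least? f′ v ×-dec connected? f′ v d) Sign.-) ·
    Π.big (allFin n) (λ v → Π.when (least? f′ v ×-dec ¬? (connected? f′ v d)) Sign.-)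
      ≡⟨ Π.big-∙ (allFin n) ⟨
    Π.big (allFin n) (λ v → Π.when (least? f′ v ×-dec connected? f′ v d) Sign.- ·
                            Π.when (least? f′ v ×-dec ¬? (connected? f′ v d)) Sign.-)
      ≡⟨ Π.big-cong (allFin n) (λ v → Π.when-split (least? f′ v) (connected? f′ v d)) ⟨
    componentsSign f′ ∎
    where
    open ≡-Reasoning
    0~d : Connected f zero (suc d)
    0~d = connected-arc π eq₀
    to : ∀ {v} → Least f (suc v) → Least f′ v × ¬ Connected f′ v d
    to l .proj₁ w p with s≤s v≤w ← l (suc w) (connected-suc p) = v≤w
    to l .proj₂ p with () ←
      l zero (EqClosure.transitive _ (connected-suc p) (EqClosure.symmetric _ 0~d))
    from′ : ∀ {v} → Least f′ v × ¬ Connected f′ v d → Least f (suc v)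
    from′ (l , v≁d) zero    p =
      contradiction (connected-suc⁻ (EqClosure.transitive _ p 0~d)) v≁d
    from′ (l , v≁d) (suc w) p = s≤s (l w (connected-suc⁻ p))

sgn-fixed : {g : Fin (suc n) → Fin (suc n)} {π′ : Fin n → Fin n} →
            g zero ≡ zero → (∀ v → g (suc v) ≡ suc (π′ v)) → sgn g ≡ sgn π′
sgn-fixed {n} {g} {π′} eq₀ eqₛ = cong₂ _·_
  (trans (cong (λ c → smallerSign c (g ∘ suc)) eq₀) (Π.big-ε (allFin n) (λ _ → refl)))
  (trans (sgn-cong eqₛ) (sgn-suc π′))
  where
  sgn-suc : ∀ {m n} (f : Fin n → Fin m) → sgn (λ v → Fin.suc (f v)) ≡ sgn f
  sgn-suc {n = zero}  f = refl
  sgn-suc {n = suc n} f = cong (smallerSign (f zero) (f ∘ suc) ·_) (sgn-suc (f ∘ suc))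

restriction : {g : Fin (suc n) → Fin (suc n)} → Inj _≡_ _≡_ g → g zero ≡ zero →
              ∃[ π′ ] Inj _≡_ _≡_ π′ × (∀ v → g (suc v) ≡ suc (π′ v))
restriction {g = g} inj eq₀ =
  (λ v → punchOut (0≢ v)) ,
  (λ {u} {v} eq → Fin.suc-injective (inj (Fin.punchOut-injective (0≢ u) (0≢ v) eq))) ,
  (λ v → sym (Fin.punchIn-punchOut (0≢ v)))
  where
  0≢ : ∀ v → zero ≢ g (suc v)
  0≢ v 0≡ = Fin.0≢1+n (inj (trans eq₀ 0≡))

-- The predecessor `suc q` of 0 receives the value `π zero` in the exchange, so the cycle now skips
-- 0.
swapped-contracts : {π g : Fin (suc n) → Fin (suc n)} {π′ : Fin n → Fin n} {q : Fin n} →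
                    π (suc q) ≡ zero → Swapped zero (suc q) π g →
                    (∀ v → g (suc v) ≡ suc (π′ v)) → Contracts π π′
swapped-contracts {q = q} eq s eqₛ v with v Fin.≟ q
... | yes refl = inj₂ (eq , trans (sym (Swapped.at₂ s)) (eqₛ q))
... | no v≢q   = inj₁ (trans (sym (Swapped.off s (λ ()) (v≢q ∘ Fin.suc-injective))) (eqₛ v))

-- Induction by deleting 0. If 0 is fixed, one class and one vertex are lost and their two signs
-- cancel. Otherwise the values at 0 and at its preimage are exchanged, which fixes 0 at the cost of
-- one sign; the number of classes stays the same, and the lost vertex accounts for that sign.
sgn-components : (π : Fin n → Fin n) → Inj _≡_ _≡_ π →
                 sgn π ≡ componentsSign (graph π) · Π.big (allFin n) λ _ → Sign.-
sgn-components {zero}  π inj = refl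
sgn-components {suc n} π inj with injective⇒surjective inj zero
... | zero , eq₀ = begin
  sgn π                                  ≡⟨ sgn-fixed {g = π} eq₀ eqₛ ⟩
  sgn π′                                 ≡⟨ sgn-components π′ inj′ ⟩
  componentsSign (graph π′) · Π′         ≡⟨ cancel (componentsSign (graph π′)) Π′ ⟩
  opposite (componentsSign (graph π′)) · opposite Π′
    ≡⟨ cong₂ _·_ (Contraction.componentsSign-fixed {π = π} (inj₁ ∘ eqₛ) eq₀)
                 (Π.big-suc {n = n} (λ _ → Sign.-)) ⟨
  componentsSign (graph π) · Π.big (allFin (suc n)) (λ _ → Sign.-) ∎
  where
  open ≡-Reasoning
  r    = restriction inj eq₀
  π′   = proj₁ r
  inj′ = proj₁ (proj₂ r)
  eqₛ  = proj₂ (proj₂ r)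
  Π′   = Π.big (allFin n) (λ _ → Sign.-)
  cancel : ∀ s t → s · t ≡ opposite s · opposite t
  cancel s t = sym (trans (opposite-·ˡ s (opposite t))
    (trans (cong opposite (opposite-·ʳ s t)) (Sign.opposite-involutive (s · t))))
... | suc q , eq = begin
  sgn π                                  ≡⟨ Sign.opposite-involutive (sgn π) ⟨
  opposite (opposite (sgn π))            ≡⟨ cong opposite (sgn-swapped Fin.0≢1+n inj s) ⟨
  opposite (sgn g)                       ≡⟨ cong opposite (sgn-fixed {g = g} g0 eqₛ) ⟩
  opposite (sgn π′)                      ≡⟨ cong opposite (sgn-components π′ inj′) ⟩
  opposite (componentsSign (graph π′) · Π′)
    ≡⟨ opposite-·ʳ (componentsSign (graph π′)) Π′ ⟨
  componentsSign (graph π′) · opposite Π′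
    ≡⟨ cong₂ _·_ (Contraction.componentsSign-moved {π = π} (swapped-contracts eq s eqₛ) π0)
                 (Π.big-suc {n = n} (λ _ → Sign.-)) ⟨
  componentsSign (graph π) · Π.big (allFin (suc n)) (λ _ → Sign.-) ∎
  where
  open ≡-Reasoning
  g    = π ∘ transpose zero (suc q)
  s : Swapped zero (suc q) π g
  s    = swapped-transpose zero (suc q) π
  g0   = trans (Swapped.at₁ s) eq
  r    = restriction (swapped-injective inj s) g0
  π′   = proj₁ r
  inj′ = proj₁ (proj₂ r)
  eqₛ  = proj₂ (proj₂ r)
  Π′   = Π.big (allFin n) (λ _ → Sign.-)
  π0 : π zero ≡ suc (π′ q)
  π0   = trans (sym (Swapped.at₂ s)) (eqₛ q)

alternating-evenCycles-graph : (π : Fin n → Fin n) → Inj _≡_ _≡_ π →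
                               alternating (evenCycles (graph π)) ≡ sgn π
alternating-evenCycles-graph π inj =
  trans (alternating-evenCycles (graph π)) (sym (sgn-components π inj))

-- Signs of contributors

big-mapMaybe : (g : A → Maybe B) (h : B → Sign) (xs : List A) →
               Π.big (mapMaybe g xs) h ≡ Π.big xs (maybe h Sign.+ ∘ g)
big-mapMaybe g h [] = refl
big-mapMaybe g h (a ∷ xs) with g a
... | just b  = cong (h b ·_) (big-mapMaybe g h xs)
... | nothing = big-mapMaybe g h xs

-- Functionality excludes a second arc out of `v`, injectivity a second arc into it, so no path
-- leaves `v` in either direction.
connected-fixed : (f : PartialMap n n) → Injective f → ∀ {v w} →
                  Maps f v v → Connected f v w → v ≡ w
connected-fixed f inj m Star.ε = refl
connected-fixed f inj m (fwd r ◅ p) with refl ← just-injective (trans (sym m) r) =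
  connected-fixed f inj m p
connected-fixed f inj m (bwd r ◅ p) with refl ← inj _ _ _ m r = connected-fixed f inj m p

module ContributorSign (G : OrientedHypergraph) where
  open OrientedHypergraph G

  -- The minus sign is the one in front of the Laplacian. Over a component with k steps it produces
  -- the factor (-1)^k of the criterion for negative components.
  stepSign : I × I → Sign
  stepSign (i , j) = opposite (σ i · σ j)

  entrySign : Maybe (I × I) → Sign
  entrySign = maybe stepSign Sign.+

  familySign : Family → Sign
  familySign c = Π.big (allFin ∣V∣) λ v → entrySign (lookup c v)

  stepsSign : (xs : List (I × I)) →
    -1ℤ ^ length xs ℤ.* prodOver ℤ.+-*-rawRing xs (λ (i , j) → σℤ i ℤ.* σℤ j) ≡ toℤ (Π.big xs stepSign)
  stepsSign [] = refl
  stepsSign ((i , j) ∷ xs) = begin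
    (-1ℤ ℤ.* s) ℤ.* (σℤ i ℤ.* σℤ j ℤ.* t)  ≡⟨ rearrange s (σℤ i) (σℤ j) t ⟩
    - (σℤ i ℤ.* σℤ j) ℤ.* (s ℤ.* t)
      ≡⟨ cong₂ (λ s t → - s ℤ.* t) (sym (toℤ-* (σ i) (σ j))) (stepsSign xs) ⟩
    - toℤ (σ i · σ j) ℤ.* toℤ (Π.big xs stepSign)
      ≡⟨ cong (ℤ._* toℤ (Π.big xs stepSign)) (toℤ-opposite (σ i · σ j)) ⟨
    toℤ (stepSign (i , j)) ℤ.* toℤ (Π.big xs stepSign)
      ≡⟨ toℤ-* (stepSign (i , j)) (Π.big xs stepSign) ⟨
    toℤ (stepSign (i , j) · Π.big xs stepSign) ∎
    where
    open ≡-Reasoning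
    s = -1ℤ ^ length xs
    t = prodOver ℤ.+-*-rawRing xs (λ (i , j) → σℤ i ℤ.* σℤ j)
    rearrange : ∀ x s t y → (-1ℤ ℤ.* x) ℤ.* (s ℤ.* t ℤ.* y) ≡ - (s ℤ.* t) ℤ.* (x ℤ.* y)
    rearrange = solve-∀

  componentSign≡ : ∀ c v →
    componentSign c v ≡ toℤ (Π.big (component (permOf c) v) (entrySign ∘ lookup c))
  componentSign≡ c v = trans (stepsSign (stepsInComponent c v))
    (cong toℤ (big-mapMaybe (lookup c) stepSign (component (permOf c) v)))

  permOf-step : ∀ c {v i j} → lookup c v ≡ just (i , j) → Maps (permOf c) v (ς j)
  permOf-step c {v} eq = trans (Vec.lookup-map v _ c) (cong (Maybe.map (ς ∘ proj₂)) eq)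

  module _ {c : Family} (steps : ∀ v → All (IsStep v) (lookup c v))
           (injective : Injective (permOf c)) where

    private
      f = permOf c
      Vs = allFin ∣V∣

    backstep-isolated : ∀ {v w} → Backstep c v → Connected f v w → v ≡ w
    backstep-isolated {v} (i , eq) with just (ςi≡v , _) ← subst (All (IsStep v)) eq (steps v) =
      connected-fixed f injective (subst (Maps f v) ςi≡v (permOf-step c eq))

    backstep-component : ∀ {v} → Backstep c v →
                         Π.big (component f v) (entrySign ∘ lookup c) ≡ Sign.-
    backstep-component {v} b@(i , eq) = begin
      Π.big (component f v) (entrySign ∘ lookup c)
        ≡⟨ Π.big-filter (connected? f v) Vs ⟩
      Π.big Vs (λ w → Π.when (connected? f v w) (entrySign (lookup c w)))
        ≡⟨ Π.big-single (allFin-enumerates ∣V∣) v (λ w w≢v →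
             Π.when-no (connected? f v w) (w≢v ∘ sym ∘ backstep-isolated b)) ⟩
      Π.when (connected? f v v) (entrySign (lookup c v))
        ≡⟨ Π.when-yes (connected? f v v) Star.ε ⟩
      entrySign (lookup c v)
        ≡⟨ cong entrySign eq ⟩
      opposite (σ i · σ i)
        ≡⟨ cong opposite (Sign.s*s≡+ (σ i)) ⟩
      Sign.- ∎
      where open ≡-Reasoning

    -- A backstep is a whole component of sign -σ(i)² = -1 and is recorded by the backstep count.
    -- Any other component is recorded by the negative count exactly when its sign is -1. At a
    -- vertex that is not least, all factors are trivial.
    componentSign-split : ∀ v →
      Π.when (least? f v) (Π.big (component f v) (entrySign ∘ lookup c))
        ≡ Π.when (negativeComponent? c v) Sign.- · Π.when (backstep? c v) Sign.-
    componentSign-split v = split (backstep? c v) (least? f v)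
      where
      open ≡-Reasoning
      s = Π.big (component f v) (entrySign ∘ lookup c)
      split : Dec (Backstep c v) → Dec (Least f v) →
        Π.when (least? f v) s ≡ Π.when (negativeComponent? c v) Sign.- · Π.when (backstep? c v) Sign.-
      split (yes b) _ = begin
        Π.when (least? f v) s
          ≡⟨ Π.when-yes (least? f v) (λ w p → Fin.≤-reflexive (backstep-isolated b p)) ⟩
        s
          ≡⟨ backstep-component b ⟩
        Sign.+ · Sign.-
          ≡⟨ cong₂ _·_ (Π.when-no (negativeComponent? c v) λ (_ , ¬b , _) → ¬b b)
                       (Π.when-yes (backstep? c v) b) ⟨
        Π.when (negativeComponent? c v) Sign.- · Π.when (backstep? c v) Sign.- ∎
      split (no ¬b) (no ¬l) = begin
        Π.when (least? f v) s
          ≡⟨ Π.when-no (least? f v) ¬l ⟩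
        Sign.+ · Sign.+
          ≡⟨ cong₂ _·_ (Π.when-no (negativeComponent? c v) λ (l , _) → ¬l l)
                       (Π.when-no (backstep? c v) ¬b) ⟨
        Π.when (negativeComponent? c v) Sign.- · Π.when (backstep? c v) Sign.- ∎
      split (no ¬b) (yes l) = begin
        Π.when (least? f v) s
          ≡⟨ Π.when-yes (least? f v) l ⟩
        s
          ≡⟨ Sign.*-identityʳ s ⟨
        s · Sign.+
          ≡⟨ cong₂ _·_ (negative s (componentSign≡ c v)) (Π.when-no (backstep? c v) ¬b) ⟨
        Π.when (negativeComponent? c v) Sign.- · Π.when (backstep? c v) Sign.- ∎
        where
        negative : ∀ s → componentSign c v ≡ toℤ s → Π.when (negativeComponent? c v) Sign.- ≡ s
        negative Sign.- eq = Π.when-yes (negativeComponent? c v) (l , ¬b , eq)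
        negative Sign.+ eq = Π.when-no (negativeComponent? c v) λ (_ , _ , neg) →
          contradiction (trans (sym eq) neg) λ ()

    familySign≡ : familySign c ≡ alternating (negativeComponents c) · alternating (backsteps c)
    familySign≡ = begin
      familySign c
        ≡⟨ Components.big-partition f Sign.*-commutativeMonoid (entrySign ∘ lookup c) ⟨
      Π.big Vs (λ v → Π.when (least? f v) (Π.big (component f v) (entrySign ∘ lookup c)))
        ≡⟨ Π.big-cong Vs componentSign-split ⟩
      Π.big Vs (λ v → Π.when (negativeComponent? c v) Sign.- · Π.when (backstep? c v) Sign.-)
        ≡⟨ Π.big-∙ Vs ⟩
      Π.big Vs (λ v → Π.when (negativeComponent? c v) Sign.-) ·
      Π.big Vs (λ v → Π.when (backstep? c v) Sign.-)
        ≡⟨ cong₂ _·_ (alternating-filter (negativeComponent? c) Vs)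
                     (alternating-filter (backstep? c) Vs) ⟨
      alternating (negativeComponents c) · alternating (backsteps c) ∎
      where open ≡-Reasoning

-- Sums and products in a commutative semiring

module SemiringSums {c ℓ} (R : CommutativeSemiring c ℓ) where
  open CommutativeSemiring R hiding (zero) renaming
    (_+_ to _⊕_; _*_ to _⊗_; refl to ≈-refl; sym to ≈-sym; trans to ≈-trans)
  open import Relation.Binary.Reasoning.Setoid setoid
  module ∑ = BigOperator +-commutativeMonoid
  module ∏ = BigOperator *-commutativeMonoid

  ∑-distribˡ : (s : Carrier) (xs : List B) {f : B → Carrier} →
               s ⊗ ∑.big xs f ≈ ∑.big xs (λ b → s ⊗ f b)
  ∑-distribˡ s []       = zeroʳ s
  ∑-distribˡ s (b ∷ xs) = ≈-trans (distribˡ s _ _) (+-congˡ (∑-distribˡ s xs))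

  ∑-distribʳ : (s : Carrier) (xs : List B) {f : B → Carrier} →
               ∑.big xs f ⊗ s ≈ ∑.big xs (λ b → f b ⊗ s)
  ∑-distribʳ s xs = ≈-trans (*-comm _ s)
    (≈-trans (∑-distribˡ s xs) (∑.big-cong xs (λ b → *-comm s _)))

  when-*ˡ : {P : Set p} (d : Dec P) (s t : Carrier) → ∑.when d s ⊗ t ≈ ∑.when d (s ⊗ t)
  when-*ˡ (yes _) s t = ≈-refl
  when-*ˡ (no _)  s t = zeroˡ t

  when-*ʳ : {P : Set p} (d : Dec P) (s t : Carrier) → s ⊗ ∑.when d t ≈ ∑.when d (s ⊗ t)
  when-*ʳ (yes _) s t = ≈-refl
  when-*ʳ (no _)  s t = zeroʳ s

  ∏-∑ : (n : ℕ) (xs : List B) (f : Fin n → B → Carrier) →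
        ∏.big (allFin n) (λ v → ∑.big xs (f v))
          ≈ ∑.big (vectorsOver xs n) (λ t → ∏.big (allFin n) (λ v → f v (lookup t v)))
  ∏-∑ zero    xs f = ≈-sym (+-identityʳ 1#)
  ∏-∑ (suc n) xs f = begin
    ∏.big (allFin (suc n)) (λ v → ∑.big xs (f v))
      ≡⟨ ∏.big-suc (λ v → ∑.big xs (f v)) ⟩
    ∑.big xs (f zero) ⊗ ∏.big (allFin n) (λ v → ∑.big xs (f (suc v)))
      ≈⟨ *-congˡ (∏-∑ n xs (λ v → f (suc v))) ⟩
    ∑.big xs (f zero) ⊗ ∑.big ts (λ t → ∏.big (allFin n) (λ v → f (suc v) (lookup t v)))
      ≈⟨ ∑-distribʳ _ xs ⟩
    ∑.big xs (λ b → f zero b ⊗ ∑.big ts (λ t → ∏.big (allFin n) (λ v → f (suc v) (lookup t v))))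
      ≈⟨ ∑.big-cong xs (λ b → ∑-distribˡ (f zero b) ts) ⟩
    ∑.big xs (λ b → ∑.big ts (λ t → f zero b ⊗ ∏.big (allFin n) (λ v → f (suc v) (lookup t v))))
      ≈⟨ ∑.big-cong xs (λ b → ∑.big-cong ts (λ t →
           reflexive (∏.big-suc (λ v → f v (lookup (b ∷ t) v))))) ⟨
    ∑.big xs (λ b → ∑.big ts (λ t → ∏.big (allFin (suc n)) (λ v → f v (lookup (b ∷ t) v))))
      ≈⟨ ∑.big-cartesianProductWith _∷_ xs ts ⟨
    ∑.big (vectorsOver xs (suc n)) (λ t → ∏.big (allFin (suc n)) (λ v → f v (lookup t v))) ∎
    where ts = vectorsOver xs n

  ∏-when : {P : Fin n → Set p} (P? : ∀ v → Dec (P v)) (∀P? : Dec (∀ v → P v)) (f : Fin n → Carrier) →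
           ∏.big (allFin n) (λ v → ∑.when (P? v) (f v)) ≈ ∑.when ∀P? (∏.big (allFin n) f)
  ∏-when {n = n} P? (yes ∀P) f =
    ∏.big-cong (allFin n) (λ v → reflexive (∑.when-yes (P? v) (∀P v)))
  ∏-when {n = n} P? (no ¬∀P) f with v , ¬Pv ← Fin.¬∀⟶∃¬ n _ P? ¬∀P = vanishes (∈-allFin v)
    where
    vanishes : {xs : List (Fin n)} → v ∈ xs → ∏.big xs (λ v → ∑.when (P? v) (f v)) ≈ 0#
    vanishes (here refl) = ≈-trans (*-congʳ (reflexive (∑.when-no (P? v) ¬Pv))) (zeroˡ _)
    vanishes (there v∈)  = ≈-trans (*-congˡ (vanishes v∈)) (zeroʳ _)

-- Polynomials

module Polynomials (k : ℕ) where
  open RawRing (polyRing k) using () renaming (_*_ to _*ₚ_)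
  open SemiringSums ℤ.+-*-commutativeSemiring

  _≟ₘ_ : DecidableEquality (Monomial k)
  _≟ₘ_ = Vec.≡-dec ℕ._≟_

  _∔_ : Monomial k → Monomial k → Monomial k
  _∔_ = zipWith ℕ._+_

  one : Monomial k
  one = replicate k 0

  -- The ℤ-linear extension of F to polynomials; these functionals separate
  -- polynomials and turn the ring laws into identities between double sums.
  ⟦_⟧ : (Monomial k → ℤ) → Poly k → ℤ
  ⟦ F ⟧ p = ∑.big p λ (c , μ) → c ℤ.* F μ

  ⟦⟧-cong : {F F′ : Monomial k → ℤ} → F ≗ F′ → ∀ p → ⟦ F ⟧ p ≡ ⟦ F′ ⟧ p
  ⟦⟧-cong F≗ p = ∑.big-cong p λ (c , μ) → cong (c ℤ.*_) (F≗ μ)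

  ⟦⟧-* : ∀ F p q → ⟦ F ⟧ (p *ₚ q) ≡ ⟦ (λ μ → ⟦ (λ ν → F (μ ∔ ν)) ⟧ q) ⟧ p
  ⟦⟧-* F p q = trans (∑.big-cartesianProductWith _ p q) (∑.big-cong p λ (b , μ) →
    trans (∑.big-cong q (λ (c , ν) → ℤ.*-assoc b c (F (μ ∔ ν)))) (sym (∑-distribˡ b q)))

  coeff≡ : ∀ p μ → coeff p μ ≡ ⟦ (λ ν → ∑.when (ν ≟ₘ μ) 1ℤ) ⟧ p
  coeff≡ p μ = trans (∑.big-filter (λ t → proj₂ t ≟ₘ μ) p) (∑.big-cong p λ (c , ν) →
    sym (trans (when-*ʳ (ν ≟ₘ μ) c 1ℤ) (∑.when-cong (ν ≟ₘ μ) (λ _ → ℤ.*-identityʳ c))))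

  -- Like terms are collected. `S` may contain monomials that do not occur in `p`, as their
  -- coefficients are 0; this allows two polynomials to be evaluated over one common list and
  -- compared coefficient by coefficient.
  support : ∀ F p {S} → Unique S → (∀ {t} → t ∈ p → proj₂ t ∈ S) →
            ⟦ F ⟧ p ≡ ∑.big S (λ μ → coeff p μ ℤ.* F μ)
  support F []            {S} u p⊆S = sym (∑.big-ε S (λ {μ} _ → ℤ.*-zeroˡ (F μ)))
  support F ((c , ν) ∷ p) {S} u p⊆S = begin
    c ℤ.* F ν + ⟦ F ⟧ p
      ≡⟨ cong₂ _+_ (sym single) (support F p u (p⊆S ∘ there)) ⟩
    ∑.big S (λ μ → ∑.when (ν ≟ₘ μ) c ℤ.* F μ) + ∑.big S (λ μ → coeff p μ ℤ.* F μ)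
      ≡⟨ ∑.big-∙ S ⟨
    ∑.big S (λ μ → ∑.when (ν ≟ₘ μ) c ℤ.* F μ + coeff p μ ℤ.* F μ)
      ≡⟨ ∑.big-cong S (λ μ → trans (sym (ℤ.*-distribʳ-+ (F μ) (∑.when (ν ≟ₘ μ) c) (coeff p μ)))
           (cong (ℤ._* F μ) (sym (coeff-∷ μ)))) ⟩
    ∑.big S (λ μ → coeff ((c , ν) ∷ p) μ ℤ.* F μ) ∎
    where
    open ≡-Reasoning
    coeff-∷ : ∀ μ → coeff ((c , ν) ∷ p) μ ≡ ∑.when (ν ≟ₘ μ) c + coeff p μ
    coeff-∷ μ with does (ν ≟ₘ μ)
    ... | true  = refl
    ... | false = sym (ℤ.+-identityˡ (coeff p μ))
    single : ∑.big S (λ μ → ∑.when (ν ≟ₘ μ) c ℤ.* F μ) ≡ c ℤ.* F ν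
    single = trans
      (∑.big-unique u (p⊆S (here refl)) (λ μ μ≢ν →
        trans (cong (ℤ._* F μ) (∑.when-no (ν ≟ₘ μ) (μ≢ν ∘ sym))) (ℤ.*-zeroˡ (F μ))))
      (cong (ℤ._* F ν) (∑.when-yes (ν ≟ₘ ν) refl))

  ≈ₚ⇒⟦⟧ : ∀ F p q → p ≈ₚ q → ⟦ F ⟧ p ≡ ⟦ F ⟧ q
  ≈ₚ⇒⟦⟧ F p q p≈q = begin
    ⟦ F ⟧ p                          ≡⟨ support F p S-unique (λ t∈ → inS (∈-++⁺ˡ t∈)) ⟩
    ∑.big S (λ μ → coeff p μ ℤ.* F μ)  ≡⟨ ∑.big-cong S (λ μ → cong (ℤ._* F μ) (p≈q μ)) ⟩
    ∑.big S (λ μ → coeff q μ ℤ.* F μ)  ≡⟨ support F q S-unique (λ t∈ → inS (∈-++⁺ʳ p t∈)) ⟨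
    ⟦ F ⟧ q                          ∎
    where
    open ≡-Reasoning
    S = deduplicate _≟ₘ_ (map proj₂ (p ++ q))
    S-unique : Unique S
    S-unique = deduplicate-! _≟ₘ_ (map proj₂ (p ++ q))
    inS : ∀ {t} → t ∈ p ++ q → proj₂ t ∈ S
    inS t∈ = ∈-deduplicate⁺ _≟ₘ_ (∈-map⁺ proj₂ t∈)

  ⟦⟧⇒≈ₚ : ∀ p q → (∀ F → ⟦ F ⟧ p ≡ ⟦ F ⟧ q) → p ≈ₚ q
  ⟦⟧⇒≈ₚ p q eq μ = trans (coeff≡ p μ) (trans (eq _) (sym (coeff≡ q μ)))

  +ₚ-cong : ∀ {p p′ q q′} → p ≈ₚ p′ → q ≈ₚ q′ → p ++ q ≈ₚ p′ ++ q′
  +ₚ-cong {p} {p′} {q} {q′} p≈ q≈ = ⟦⟧⇒≈ₚ (p ++ q) (p′ ++ q′) λ F → trans (∑.big-++ p q)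
    (trans (cong₂ _+_ (≈ₚ⇒⟦⟧ F p p′ p≈) (≈ₚ⇒⟦⟧ F q q′ q≈)) (sym (∑.big-++ p′ q′)))

  *ₚ-cong : ∀ {p p′ q q′} → p ≈ₚ p′ → q ≈ₚ q′ → p *ₚ q ≈ₚ p′ *ₚ q′
  *ₚ-cong {p} {p′} {q} {q′} p≈ q≈ = ⟦⟧⇒≈ₚ (p *ₚ q) (p′ *ₚ q′) λ F → trans (⟦⟧-* F p q)
    (trans (≈ₚ⇒⟦⟧ _ p p′ p≈) (trans (⟦⟧-cong (λ μ → ≈ₚ⇒⟦⟧ _ q q′ q≈) p′) (sym (⟦⟧-* F p′ q′))))

  *ₚ-assoc : ∀ p q r → (p *ₚ q) *ₚ r ≈ₚ p *ₚ (q *ₚ r)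
  *ₚ-assoc p q r = ⟦⟧⇒≈ₚ ((p *ₚ q) *ₚ r) (p *ₚ (q *ₚ r)) λ F → begin
    ⟦ F ⟧ ((p *ₚ q) *ₚ r)
      ≡⟨ ⟦⟧-* F (p *ₚ q) r ⟩
    ⟦ (λ κ → ⟦ (λ ξ → F (κ ∔ ξ)) ⟧ r) ⟧ (p *ₚ q)
      ≡⟨ ⟦⟧-* _ p q ⟩
    ⟦ (λ μ → ⟦ (λ ν → ⟦ (λ ξ → F ((μ ∔ ν) ∔ ξ)) ⟧ r) ⟧ q) ⟧ p
      ≡⟨ ⟦⟧-cong (λ μ → ⟦⟧-cong (λ ν → ⟦⟧-cong (λ ξ →
           cong F (Vec.zipWith-assoc ℕ.+-assoc μ ν ξ)) r) q) p ⟩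
    ⟦ (λ μ → ⟦ (λ ν → ⟦ (λ ξ → F (μ ∔ (ν ∔ ξ))) ⟧ r) ⟧ q) ⟧ p
      ≡⟨ ⟦⟧-cong (λ μ → ⟦⟧-* (λ ν → F (μ ∔ ν)) q r) p ⟨
    ⟦ (λ μ → ⟦ (λ ν → F (μ ∔ ν)) ⟧ (q *ₚ r)) ⟧ p
      ≡⟨ ⟦⟧-* F p (q *ₚ r) ⟨
    ⟦ F ⟧ (p *ₚ (q *ₚ r)) ∎
    where open ≡-Reasoning

  *ₚ-comm : ∀ p q → p *ₚ q ≈ₚ q *ₚ p
  *ₚ-comm p q = ⟦⟧⇒≈ₚ (p *ₚ q) (q *ₚ p) λ F → begin
    ⟦ F ⟧ (p *ₚ q)
      ≡⟨ ∑.big-cartesianProductWith _ p q ⟩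
    ∑.big p (λ (b , μ) → ∑.big q (λ (c , ν) → b ℤ.* c ℤ.* F (μ ∔ ν)))
      ≡⟨ ∑.big-swap p q ⟩
    ∑.big q (λ (c , ν) → ∑.big p (λ (b , μ) → b ℤ.* c ℤ.* F (μ ∔ ν)))
      ≡⟨ ∑.big-cong q (λ (c , ν) → ∑.big-cong p (λ (b , μ) →
           cong₂ (λ d κ → d ℤ.* F κ) (ℤ.*-comm b c) (Vec.zipWith-comm ℕ.+-comm μ ν))) ⟩
    ∑.big q (λ (c , ν) → ∑.big p (λ (b , μ) → c ℤ.* b ℤ.* F (ν ∔ μ)))
      ≡⟨ ∑.big-cartesianProductWith _ q p ⟨
    ⟦ F ⟧ (q *ₚ p) ∎
    where open ≡-Reasoning

  *ₚ-identityˡ : ∀ p → constant 1ℤ *ₚ p ≈ₚ p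
  *ₚ-identityˡ p = ⟦⟧⇒≈ₚ (constant 1ℤ *ₚ p) p λ F → trans (⟦⟧-* F (constant 1ℤ) p)
    (trans (ℤ.+-identityʳ _) (trans (ℤ.*-identityˡ _)
      (⟦⟧-cong (λ ν → cong F (Vec.zipWith-identityˡ ℕ.+-identityˡ ν)) p)))

  *ₚ-distribʳ : ∀ p q r → (q ++ r) *ₚ p ≈ₚ q *ₚ p ++ r *ₚ p
  *ₚ-distribʳ p q r = ⟦⟧⇒≈ₚ ((q ++ r) *ₚ p) (q *ₚ p ++ r *ₚ p) λ F → trans (⟦⟧-* F (q ++ r) p)
    (trans (∑.big-++ q r) (sym (trans (∑.big-++ (q *ₚ p) (r *ₚ p))
      (cong₂ _+_ (⟦⟧-* F q p) (⟦⟧-* F r p)))))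

  +ₚ-comm : ∀ p q → p ++ q ≈ₚ q ++ p
  +ₚ-comm p q = ⟦⟧⇒≈ₚ (p ++ q) (q ++ p) λ F →
    trans (∑.big-++ p q) (trans (ℤ.+-comm (⟦ F ⟧ p) (⟦ F ⟧ q)) (sym (∑.big-++ q p)))

  ≈ₚ-isEquivalence : IsEquivalence (_≈ₚ_ {k})
  ≈ₚ-isEquivalence = record
    { refl  = λ _ → refl
    ; sym   = λ p≈q μ → sym (p≈q μ)
    ; trans = λ p≈q q≈r μ → trans (p≈q μ) (q≈r μ)
    }

  commutativeSemiring : CommutativeSemiring 0ℓ 0ℓ
  commutativeSemiring = record
    { Carrier = Poly k
    ; _≈_ = _≈ₚ_
    ; _+_ = _++_
    ; _*_ = _*ₚ_
    ; 0# = []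
    ; 1# = constant 1ℤ
    ; isCommutativeSemiring = isCommutativeSemiringˡ record
      { +-isCommutativeMonoid = isCommutativeMonoidˡ record
        { isSemigroup = record
          { isMagma = record { isEquivalence = ≈ₚ-isEquivalence ; ∙-cong = λ {p} {p′} → +ₚ-cong {p} {p′} }
          ; assoc = λ p q r μ → cong (λ s → coeff s μ) (List.++-assoc p q r)
          }
        ; identityˡ = λ _ _ → refl
        ; comm = +ₚ-comm
        }
      ; *-isCommutativeMonoid = isCommutativeMonoidˡ record
        { isSemigroup = record
          { isMagma = record { isEquivalence = ≈ₚ-isEquivalence ; ∙-cong = λ {p} {p′} → *ₚ-cong {p} {p′} }
          ; assoc = *ₚ-assoc
          }
        ; identityˡ = *ₚ-identityˡ
        ; comm = *ₚ-comm
        }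
      ; distribʳ = *ₚ-distribʳ
      ; zeroˡ = λ _ _ → refl
      }
    }

  constant-+ : ∀ b c → constant (b + c) ≈ₚ constant b ++ constant c
  constant-+ b c = ⟦⟧⇒≈ₚ (constant (b + c)) (constant b ++ constant c) λ F →
    trans (ℤ.+-identityʳ _) (trans (ℤ.*-distribʳ-+ (F one) b c)
      (cong (λ z → b ℤ.* F one + z) (sym (ℤ.+-identityʳ (c ℤ.* F one)))))

  constant-* : ∀ b c → constant (b ℤ.* c) ≈ₚ constant b *ₚ constant c
  constant-* b c μ = cong (λ ν → coeff ((b ℤ.* c , ν) ∷ []) μ)
    (sym (Vec.zipWith-identityˡ ℕ.+-identityˡ one))

  constant-0 : constant 0ℤ ≈ₚ []
  constant-0 = ⟦⟧⇒≈ₚ (constant 0ℤ) [] λ F → trans (ℤ.+-identityʳ _) (ℤ.*-zeroˡ (F one))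

  constant-isHomomorphism : IsSemiringHomomorphism
    ℤ.+-*-rawSemiring (CommutativeSemiring.rawSemiring commutativeSemiring) constant
  constant-isHomomorphism = record
    { isNearSemiringHomomorphism = record
      { +-isMonoidHomomorphism = record
        { isMagmaHomomorphism = record
          { isRelHomomorphism = record { cong = λ where refl _ → refl }
          ; homo = constant-+
          }
        ; ε-homo = constant-0
        }
      ; *-homo = constant-*
      }
    ; 1#-homo = λ _ → refl
    }

-- Expansion of the determinant

module ℤS = SemiringSums ℤ.+-*-commutativeSemiring
module Σ = ℤS.∑

Σ-neg : (xs : List B) {f : B → ℤ} → Σ.big xs (λ b → - f b) ≡ - Σ.big xs f
Σ-neg []           = refl
Σ-neg (b ∷ xs) {f} = trans (cong (- f b +_) (Σ-neg xs)) (sym (ℤ.neg-distrib-+ (f b) (Σ.big xs f)))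

Σ-when-neg : (d : Dec P) (z : ℤ) → Σ.when d (- z) ≡ - Σ.when d z
Σ-when-neg (yes _) z = refl
Σ-when-neg (no _)  z = refl

module Fitting (G : OrientedHypergraph) where
  open OrientedHypergraph G
  open ContributorSign G

  -- The arguments `m` and `s` are the choices of an indeterminate and of a step in row `v`. Making
  -- neither choice or both is excluded here, which later yields the domain condition on reduced
  -- contributors.
  Fits : V → Maybe V → Maybe (I × I) → V → Set
  Fits v (just u) nothing  w = u ≡ w
  Fits v nothing  (just s) w = IsStep v s × ς (proj₂ s) ≡ w
  Fits v nothing  nothing  w = ⊥
  Fits v (just _) (just _) w = ⊥

  fits? : ∀ v m s → U.Decidable (Fits v m s)
  fits? v (just u) nothing  w = u Fin.≟ w
  fits? v nothing  (just s) w = isStep? v s ×-dec (ς (proj₂ s) Fin.≟ w)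
  fits? v nothing  nothing  w = no λ ()
  fits? v (just _) (just _) w = no λ ()

  Extends : PartialMap ∣V∣ ∣V∣ → Family → Vec V ∣V∣ → Set
  Extends φ c π = ∀ v → Fits v (lookup φ v) (lookup c v) (lookup π v)

  extends? : ∀ φ c → U.Decidable (Extends φ c)
  extends? φ c π = Fin.all? λ v → fits? v (lookup φ v) (lookup c v) (lookup π v)

  incidencePairs : List (I × I)
  incidencePairs = cartesianProduct (allFin ∣I∣) (allFin ∣I∣)

  families : List Family
  families = vectorsOver (allMaybe incidencePairs) ∣V∣

  families-enumerates : Enumerates families
  families-enumerates = vectorsOver-enumerates (allMaybe-enumerates
    (cartesianProduct-enumerates (allFin-enumerates ∣I∣) (allFin-enumerates ∣I∣))) ∣V∣

  selfMaps : List (Vec V ∣V∣)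
  selfMaps = vectorsOver (allFin ∣V∣) ∣V∣

  selfMaps-enumerates : Enumerates selfMaps
  selfMaps-enumerates = vectorsOver-enumerates (allFin-enumerates ∣V∣) ∣V∣

  partialMaps : List (PartialMap ∣V∣ ∣V∣)
  partialMaps = vectorsOver (allMaybe (allFin ∣V∣)) ∣V∣

  -- The coefficient with which the pair (φ, c) enters the determinant. It remains a sum over all
  -- `π`, although at most one fits, so that the cancellation can reindex `π` without deciding
  -- whether one exists.
  extensionSum : PartialMap ∣V∣ ∣V∣ → Family → ℤ
  extensionSum φ c = Σ.big selfMaps λ π →
    Σ.when (isPermutation? π ×-dec extends? φ c π) (toℤ (sgn (lookup π) · familySign c))

  incidence : V → E → I → ℤ
  incidence v e i = Σ.when ((ς i Fin.≟ v) ×-dec (ω i Fin.≟ e)) (σℤ i)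

  -laplacian≡ : ∀ v w → - laplacian v w ≡
    Σ.big incidencePairs λ s → Σ.when (fits? v nothing (just s) w) (toℤ (stepSign s))
  -laplacian≡ v w = begin
    - laplacian v w
      ≡⟨ cong -_ (Σ.big-cong (allFin ∣E∣) λ e → cong₂ ℤ._*_ (Σ.big-filter _ Is) (Σ.big-filter _ Is)) ⟩
    - Σ.big (allFin ∣E∣) (λ e → Σ.big Is (incidence v e) ℤ.* Σ.big Is (incidence w e))
      ≡⟨ cong -_ (Σ.big-cong (allFin ∣E∣) λ e → trans (ℤS.∑-distribʳ _ Is)
           (Σ.big-cong Is λ i → ℤS.∑-distribˡ (incidence v e i) Is)) ⟩
    - Σ.big (allFin ∣E∣) (λ e → Σ.big Is λ i → Σ.big Is λ j → incidence v e i ℤ.* incidence w e j)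
      ≡⟨ cong -_ (trans (Σ.big-swap (allFin ∣E∣) Is)
           (Σ.big-cong Is λ i → Σ.big-swap (allFin ∣E∣) Is)) ⟩
    - Σ.big Is (λ i → Σ.big Is λ j → Σ.big (allFin ∣E∣) λ e → incidence v e i ℤ.* incidence w e j)
      ≡⟨ Σ-neg Is ⟨
    Σ.big Is (λ i → - Σ.big Is λ j → Σ.big (allFin ∣E∣) λ e → incidence v e i ℤ.* incidence w e j)
      ≡⟨ Σ.big-cong Is (λ i → trans (sym (Σ-neg Is)) (Σ.big-cong Is (pair i))) ⟩
    Σ.big Is (λ i → Σ.big Is λ j → Σ.when (fits? v nothing (just (i , j)) w) (toℤ (stepSign (i , j))))
      ≡⟨ Σ.big-cartesianProductWith _,_ Is Is ⟨
    Σ.big incidencePairs (λ s → Σ.when (fits? v nothing (just s) w) (toℤ (stepSign s))) ∎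
    where
    open ≡-Reasoning
    Is = allFin ∣I∣
    pair : ∀ i j → - Σ.big (allFin ∣E∣) (λ e → incidence v e i ℤ.* incidence w e j) ≡
                   Σ.when (fits? v nothing (just (i , j)) w) (toℤ (stepSign (i , j)))
    pair i j = begin
      - Σ.big (allFin ∣E∣) (λ e → incidence v e i ℤ.* incidence w e j)
        -- The incidence `i` lies on the edge `ω i` only. The sum over edges thus turns into the
        -- condition that `i` and `j` share their edge.
        ≡⟨ cong -_ (Σ.big-single (allFin-enumerates ∣E∣) (ω i) λ e e≢ →
             trans (cong (ℤ._* incidence w e j) (Σ.when-no (d e) (e≢ ∘ sym ∘ proj₂)))
                   (ℤ.*-zeroˡ (incidence w e j))) ⟩
      - (incidence v (ω i) i ℤ.* incidence w (ω i) j)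
        ≡⟨ cong -_ (trans (ℤS.when-*ˡ (d (ω i)) (σℤ i) _)
             (Σ.when-cong (d (ω i)) λ _ → ℤS.when-*ʳ d′ (σℤ i) (σℤ j))) ⟩
      - Σ.when (d (ω i)) (Σ.when d′ (σℤ i ℤ.* σℤ j))
        ≡⟨ cong -_ (trans (sym (Σ.when-× (d (ω i)) d′))
             (Σ.when-⇔ (mk⇔ (λ ((p , _) , (q , r)) → (p , sym r) , q)
                            (λ ((p , r) , q) → (p , refl) , (q , sym r)))
                       (d (ω i) ×-dec d′) (fits? v nothing (just (i , j)) w))) ⟩
      - Σ.when (fits? v nothing (just (i , j)) w) (σℤ i ℤ.* σℤ j)
        ≡⟨ Σ-when-neg (fits? v nothing (just (i , j)) w) (σℤ i ℤ.* σℤ j) ⟨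
      Σ.when (fits? v nothing (just (i , j)) w) (- (σℤ i ℤ.* σℤ j))
        ≡⟨ Σ.when-cong (fits? v nothing (just (i , j)) w) (λ _ →
             trans (cong -_ (sym (toℤ-* (σ i) (σ j)))) (sym (toℤ-opposite (σ i · σ j)))) ⟩
      Σ.when (fits? v nothing (just (i , j)) w) (toℤ (stepSign (i , j))) ∎
      where
      d : ∀ e → Dec (ς i ≡ v × ω i ≡ e)
      d e = (ς i Fin.≟ v) ×-dec (ω i Fin.≟ e)
      d′ : Dec (ς j ≡ w × ω j ≡ ω i)
      d′ = (ς j Fin.≟ w) ×-dec (ω j Fin.≟ ω i)

lookup-extensional : {xs ys : Vec A n} → lookup xs ≗ lookup ys → xs ≡ ys
lookup-extensional {xs = xs} {ys} eq =
  trans (sym (Vec.tabulate∘lookup xs)) (trans (Vec.tabulate-cong eq) (Vec.tabulate∘lookup ys))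

swapped-inverse : {i j : Fin n} {f g : Fin n → A} → Swapped i j f g → Swapped i j g f
swapped-inverse s = record
  { at₁ = sym (Swapped.at₂ s)
  ; at₂ = sym (Swapped.at₁ s)
  ; off = λ k≢i k≢j → sym (Swapped.off s k≢i k≢j)
  }

transpose-involutive : (i j : Fin n) → ∀ k → transpose i j (transpose i j k) ≡ k
transpose-involutive i j k = trans
  (swapped-functional (swapped-transpose i j id) (swapped-sym (swapped-transpose j i id)) (transpose i j k))
  (transpose-inverse j i)

negation-fixed : ∀ z → z ≡ - z → z ≡ 0ℤ
negation-fixed (ℤ.+ zero) _ = refl

-- Cancellation of the families that are not edge-monic

-- The failure of injectivity in positive form: the cancellation needs the two vertices themselves.
Collision : PartialMap m n → Set
Collision e = ∃[ u ] ∃[ v ] ∃[ w ] u ≢ v × Maps e u w × Maps e v w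

collision? : (e : PartialMap m n) → Dec (Collision e)
collision? e = Fin.any? λ u → Fin.any? λ v → Fin.any? λ w →
  ¬? (u Fin.≟ v) ×-dec maps? e u w ×-dec maps? e v w

¬collision⇒injective : {e : PartialMap m n} → ¬ Collision e → Injective e
¬collision⇒injective ¬coll u v w mu mv with u Fin.≟ v
... | yes u≡v = u≡v
... | no u≢v  = contradiction (u , v , w , u≢v , mu , mv) ¬coll

module Cancellation (G : OrientedHypergraph) where
  open OrientedHypergraph G
  open ContributorSign G
  open Fitting G

  -- The head of a step (i , j) is j.
  record HeadsSwapped (a b : V) (c c′ : Family) : Set where
    field
      i j k l : I
      at-a  : lookup c a ≡ just (i , j)
      at-b  : lookup c b ≡ just (k , l)
      at-a′ : lookup c′ a ≡ just (i , l)
      at-b′ : lookup c′ b ≡ just (k , j)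
      away  : ∀ {v} → v ≢ a → v ≢ b → lookup c′ v ≡ lookup c v
      edge  : ω i ≡ ω k

  headsSwapped-sym : ∀ {a b c c′} → HeadsSwapped a b c c′ → HeadsSwapped a b c′ c
  headsSwapped-sym h = record
    { at-a = at-a′ ; at-b = at-b′ ; at-a′ = at-a ; at-b′ = at-b
    ; away = λ v≢a v≢b → sym (away v≢a v≢b) ; edge = edge }
    where open HeadsSwapped h

  tailSign headSign : Maybe (I × I) → Sign
  tailSign = maybe (λ (i , _) → opposite (σ i)) Sign.+
  headSign = maybe (λ (_ , j) → σ j) Sign.+

  entrySign-split : ∀ s → entrySign s ≡ tailSign s · headSign s
  entrySign-split nothing        = refl
  entrySign-split (just (i , j)) = sym (opposite-·ˡ (σ i) (σ j))

  familySign-split : ∀ c → familySign c ≡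
    Π.big (allFin ∣V∣) (tailSign ∘ lookup c) · Π.big (allFin ∣V∣) (headSign ∘ lookup c)
  familySign-split c = trans (Π.big-cong (allFin ∣V∣) (λ v → entrySign-split (lookup c v)))
                             (Π.big-∙ (allFin ∣V∣))

  at-either : (a b : V) {P : V → Set} → P a → P b → (∀ {v} → v ≢ a → v ≢ b → P v) → ∀ v → P v
  at-either a b Pa Pb Pv v with v Fin.≟ a
  ... | yes refl = Pa
  ... | no v≢a with v Fin.≟ b
  ...   | yes refl = Pb
  ...   | no v≢b   = Pv v≢a v≢b

  -- Split into first and second incidences, the product keeps its tail factors in place and
  -- permutes its head factors.
  familySign-headsSwapped : ∀ {a b c c′} → HeadsSwapped a b c c′ → familySign c′ ≡ familySign c
  familySign-headsSwapped {a} {b} {c} {c′} h = begin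
    familySign c′
      ≡⟨ familySign-split c′ ⟩
    Π.big (allFin ∣V∣) (tailSign ∘ lookup c′) · Π.big (allFin ∣V∣) (headSign ∘ lookup c′)
      ≡⟨ cong₂ _·_ (Π.big-cong (allFin ∣V∣) tails) (big-swapped Sign.*-commutativeMonoid heads) ⟩
    Π.big (allFin ∣V∣) (tailSign ∘ lookup c) · Π.big (allFin ∣V∣) (headSign ∘ lookup c)
      ≡⟨ familySign-split c ⟨
    familySign c ∎
    where
    open ≡-Reasoning
    open HeadsSwapped h
    tails : tailSign ∘ lookup c′ ≗ tailSign ∘ lookup c
    tails = at-either a b
      (trans (cong tailSign at-a′) (sym (cong tailSign at-a)))
      (trans (cong tailSign at-b′) (sym (cong tailSign at-b)))
      (λ v≢a v≢b → cong tailSign (away v≢a v≢b))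
    heads : Swapped a b (headSign ∘ lookup c) (headSign ∘ lookup c′)
    heads = record
      { at₁ = trans (cong headSign at-a′) (sym (cong headSign at-b))
      ; at₂ = trans (cong headSign at-b′) (sym (cong headSign at-a))
      ; off = λ v≢a v≢b → cong headSign (away v≢a v≢b)
      }

  fits-just : ∀ v m {s w} → Fits v m (just s) w → m ≡ nothing × IsStep v s × ς (proj₂ s) ≡ w
  fits-just v nothing (step , eq) = refl , step , eq

  -- The common edge makes `(i , l)` and `(k , j)` steps again, and their end vertices trade places
  -- just as the values of `π` do.
  extends-swapped : ∀ {a b c c′} φ π π′ → HeadsSwapped a b c c′ →
                    Swapped a b (lookup π) (lookup π′) → Extends φ c π → Extends φ c′ π′
  extends-swapped {a} {b} {c} {c′} φ π π′ h s ext = at-either a b fit-a fit-b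
    (λ {v} v≢a v≢b → subst₂ (Fits v (lookup φ v)) (sym (away v≢a v≢b))
                            (sym (Swapped.off s v≢a v≢b)) (ext v))
    where
    open HeadsSwapped h
    ext-a = fits-just a (lookup φ a) (subst (λ s → Fits a (lookup φ a) s (lookup π a)) at-a (ext a))
    ext-b = fits-just b (lookup φ b) (subst (λ s → Fits b (lookup φ b) s (lookup π b)) at-b (ext b))
    fit-a : Fits a (lookup φ a) (lookup c′ a) (lookup π′ a)
    fit-a with φa , (ςi , _) , _ ← ext-a | _ , (_ , ωkl) , ςl ← ext-b
      rewrite φa | at-a′ = (ςi , trans edge ωkl) , trans ςl (sym (Swapped.at₁ s))
    fit-b : Fits b (lookup φ b) (lookup c′ b) (lookup π′ b)
    fit-b with _ , (_ , ωij) , ςj ← ext-a | φb , (ςk , _) , _ ← ext-b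
      rewrite φb | at-b′ = (ςk , trans (sym edge) ωij) , trans ςj (sym (Swapped.at₂ s))

  isPermutation-swapped : ∀ {a b : V} π π′ → Swapped a b (lookup π) (lookup π′) →
                          IsPermutation π → IsPermutation π′
  isPermutation-swapped π π′ s perm u v = swapped-injective (perm _ _) s

  permute : V → V → Vec V ∣V∣ → Vec V ∣V∣
  permute a b π = tabulate (lookup π ∘ transpose a b)

  permute-swapped : ∀ a b π → Swapped a b (lookup π) (lookup (permute a b π))
  permute-swapped a b π = record
    { at₁ = trans (lookup-permute a) (Swapped.at₁ t)
    ; at₂ = trans (lookup-permute b) (Swapped.at₂ t)
    ; off = λ v≢a v≢b → trans (lookup-permute _) (Swapped.off t v≢a v≢b)
    }
    where
    t = swapped-transpose a b (lookup π)
    lookup-permute : ∀ v → lookup (permute a b π) v ≡ lookup π (transpose a b v)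
    lookup-permute = Vec.lookup∘tabulate (lookup π ∘ transpose a b)

  permute-involutive : ∀ a b π → permute a b (permute a b π) ≡ π
  permute-involutive a b π = lookup-extensional λ v → begin
    lookup (permute a b (permute a b π)) v ≡⟨ Vec.lookup∘tabulate _ v ⟩
    lookup (permute a b π) (transpose a b v) ≡⟨ Vec.lookup∘tabulate _ (transpose a b v) ⟩
    lookup π (transpose a b (transpose a b v)) ≡⟨ cong (lookup π) (transpose-involutive a b v) ⟩
    lookup π v ∎
    where open ≡-Reasoning

  -- Composition with the transposition of `a` and `b` matches the permutations that fit `c` with
  -- those that fit `c′`. It reverses the sign of the permutation, while the sign of the family is
  -- preserved.
  extensionSum-headsSwapped : ∀ φ {a b c c′} → a ≢ b → HeadsSwapped a b c c′ →
                              extensionSum φ c′ ≡ - extensionSum φ c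
  extensionSum-headsSwapped φ {a} {b} {c} {c′} a≢b h = begin
    Σ.big selfMaps (term c′)
      ≡⟨ Σ.big-reindex selfMaps-enumerates (Vec.≡-dec Fin._≟_) (permute a b) (permute a b)
           (permute-involutive a b) (permute-involutive a b) ⟨
    Σ.big selfMaps (term c′ ∘ permute a b)
      ≡⟨ Σ.big-cong selfMaps flips ⟩
    Σ.big selfMaps (λ π → - term c π)
      ≡⟨ Σ-neg selfMaps ⟩
    - Σ.big selfMaps (term c) ∎
    where
    open ≡-Reasoning
    valid? : ∀ c π → Dec (IsPermutation π × Extends φ c π)
    valid? c π = isPermutation? π ×-dec extends? φ c π
    term : Family → Vec V ∣V∣ → ℤ
    term c π = Σ.when (valid? c π) (toℤ (sgn (lookup π) · familySign c))
    flips : ∀ π → term c′ (permute a b π) ≡ - term c π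
    flips π = begin
      Σ.when (valid? c′ π′) (toℤ (sgn (lookup π′) · familySign c′))
        ≡⟨ Σ.when-⇔ (mk⇔ back forth) (valid? c′ π′) (valid? c π) ⟩
      Σ.when (valid? c π) (toℤ (sgn (lookup π′) · familySign c′))
        ≡⟨ Σ.when-cong (valid? c π) (λ (perm , _) → sign-flips perm) ⟩
      Σ.when (valid? c π) (- toℤ (sgn (lookup π) · familySign c))
        ≡⟨ Σ-when-neg (valid? c π) _ ⟩
      - term c π ∎
      where
      π′ = permute a b π
      s  = permute-swapped a b π
      forth : IsPermutation π × Extends φ c π → IsPermutation π′ × Extends φ c′ π′
      forth (perm , ext) = isPermutation-swapped π π′ s perm , extends-swapped φ π π′ h s ext
      back : IsPermutation π′ × Extends φ c′ π′ → IsPermutation π × Extends φ c π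
      back (perm , ext) = isPermutation-swapped π′ π (swapped-inverse s) perm ,
        extends-swapped φ π′ π (headsSwapped-sym h) (swapped-inverse s) ext
      sign-flips : IsPermutation π →
        toℤ (sgn (lookup π′) · familySign c′) ≡ - toℤ (sgn (lookup π) · familySign c)
      sign-flips perm = begin
        toℤ (sgn (lookup π′) · familySign c′)
          ≡⟨ cong toℤ (cong₂ _·_ (sgn-swapped a≢b (perm _ _) s) (familySign-headsSwapped h)) ⟩
        toℤ (opposite (sgn (lookup π)) · familySign c)
          ≡⟨ cong toℤ (opposite-·ˡ (sgn (lookup π)) (familySign c)) ⟩
        toℤ (opposite (sgn (lookup π) · familySign c))
          ≡⟨ toℤ-opposite _ ⟩
        - toℤ (sgn (lookup π) · familySign c) ∎

  -- With the fallback of leaving `s` alone, an exchange at any two vertices preserves the domain of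
  -- a family and the edges that it uses.
  replaceHead : Maybe (I × I) → Maybe (I × I) → Maybe (I × I)
  replaceHead (just (i , _)) (just (_ , j)) = just (i , j)
  replaceHead s              _              = s

  swapHeads : V → V → Family → Family
  swapHeads a b c = tabulate λ v → replaceHead (lookup c v) (lookup c (transpose a b v))

  lookup-edgesOf : ∀ c v → lookup (edgesOf c) v ≡ Maybe.map (ω ∘ proj₁) (lookup c v)
  lookup-edgesOf c v = Vec.lookup-map v _ c

  edgesOf-swapHeads : ∀ a b c → edgesOf (swapHeads a b c) ≡ edgesOf c
  edgesOf-swapHeads a b c = lookup-extensional λ v → begin
    lookup (edgesOf (swapHeads a b c)) v
      ≡⟨ lookup-edgesOf (swapHeads a b c) v ⟩
    Maybe.map (ω ∘ proj₁) (lookup (swapHeads a b c) v)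
      ≡⟨ cong (Maybe.map (ω ∘ proj₁)) (Vec.lookup∘tabulate _ v) ⟩
    Maybe.map (ω ∘ proj₁) (replaceHead (lookup c v) (lookup c (transpose a b v)))
      ≡⟨ edge (lookup c v) (lookup c (transpose a b v)) ⟩
    Maybe.map (ω ∘ proj₁) (lookup c v)
      ≡⟨ lookup-edgesOf c v ⟨
    lookup (edgesOf c) v ∎
    where
    open ≡-Reasoning
    edge : ∀ s t → Maybe.map (ω ∘ proj₁) (replaceHead s t) ≡ Maybe.map (ω ∘ proj₁) s
    edge (just _) (just _) = refl
    edge (just _) nothing  = refl
    edge nothing  _        = refl

  edgesOf-just : ∀ c {v e} → Maps (edgesOf c) v e → ∃[ i ] ∃[ j ] lookup c v ≡ just (i , j) × ω i ≡ e
  edgesOf-just c {v} m with lookup c v | trans (sym (lookup-edgesOf c v)) m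
  ... | just (i , j) | eq = i , j , refl , just-injective eq

  swapHeads-headsSwapped : ∀ {a b e} c → Maps (edgesOf c) a e → Maps (edgesOf c) b e →
                           HeadsSwapped a b c (swapHeads a b c)
  swapHeads-headsSwapped {a} {b} c ma mb
    with i , j , at-a , ωi ← edgesOf-just c ma | k , l , at-b , ωk ← edgesOf-just c mb = record
    { at-a  = at-a
    ; at-b  = at-b
    ; at-a′ = trans (entry a) (cong₂ replaceHead at-a (trans (Swapped.at₁ t) at-b))
    ; at-b′ = trans (entry b) (cong₂ replaceHead at-b (trans (Swapped.at₂ t) at-a))
    ; away  = λ {v} v≢a v≢b → trans (entry v)
                (trans (cong (replaceHead (lookup c v)) (Swapped.off t v≢a v≢b)) (idem (lookup c v)))
    ; edge  = trans ωi (sym ωk)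
    }
    where
    t = swapped-transpose a b (lookup c)
    entry : ∀ v → lookup (swapHeads a b c) v ≡ replaceHead (lookup c v) (lookup c (transpose a b v))
    entry = Vec.lookup∘tabulate _
    idem : ∀ s → replaceHead s s ≡ s
    idem (just _) = refl
    idem nothing  = refl

  headsSwapped-functional : ∀ {a b c c′ c″} → HeadsSwapped a b c c′ → HeadsSwapped a b c c″ → c′ ≡ c″
  headsSwapped-functional {a} {b} {c} g h = lookup-extensional (at-either a b
    (trans G.at-a′ (trans (cong just (cong₂ _,_ (cong proj₁ (eq G.at-a H.at-a))
                                                (cong proj₂ (eq G.at-b H.at-b)))) (sym H.at-a′)))
    (trans G.at-b′ (trans (cong just (cong₂ _,_ (cong proj₁ (eq G.at-b H.at-b))
                                                (cong proj₂ (eq G.at-a H.at-a)))) (sym H.at-b′)))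
    (λ v≢a v≢b → trans (G.away v≢a v≢b) (sym (H.away v≢a v≢b))))
    where
    module G = HeadsSwapped g
    module H = HeadsSwapped h
    eq : ∀ {v s t} → lookup c v ≡ just s → lookup c v ≡ just t → s ≡ t
    eq p q = just-injective (trans (sym p) q)

  -- The edges and the decision are separate arguments so that, in a second application, the
  -- equality of edge maps can replace the decision for the exchanged family by the one for `c`.
  uncollide : (e : PartialMap ∣V∣ ∣E∣) → Dec (Collision e) → Family → Family
  uncollide e (yes (a , b , _)) c = swapHeads a b c
  uncollide e (no _)            c = c

  -- The pair whose heads are swapped depends on the edges of c only, and these
  -- are preserved; hence this is an involution.
  swapCollision : Family → Family
  swapCollision c = uncollide (edgesOf c) (collision? (edgesOf c)) c

  edgesOf-swapCollision : ∀ c → edgesOf (swapCollision c) ≡ edgesOf c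
  edgesOf-swapCollision c with collision? (edgesOf c)
  ... | yes (a , b , _) = edgesOf-swapHeads a b c
  ... | no _            = refl

  swapCollision-involutive : ∀ c → swapCollision (swapCollision c) ≡ c
  swapCollision-involutive c = trans
    (cong (λ e → uncollide e (collision? e) (swapCollision c)) (edgesOf-swapCollision c))
    (twice (collision? (edgesOf c)))
    where
    twice : (d : Dec (Collision (edgesOf c))) → uncollide (edgesOf c) d (uncollide (edgesOf c) d c) ≡ c
    twice (no _) = refl
    -- Both the second exchange and `c` itself arise from `swapHeads a b c` by exchanging the heads
    -- at `a` and `b`, and that result is unique.
    twice (yes (a , b , e , _ , ma , mb)) = headsSwapped-functional
      (swapHeads-headsSwapped (swapHeads a b c) (subst (λ f → Maps f a e) (sym same) ma)
                                                (subst (λ f → Maps f b e) (sym same) mb))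
      (headsSwapped-sym (swapHeads-headsSwapped c ma mb))
      where same = edgesOf-swapHeads a b c

  edgeMonic? : U.Decidable EdgeMonic
  edgeMonic? c = injective? (edgesOf c)

  extensionSum-swapCollision : ∀ φ c → ¬ EdgeMonic c →
                               extensionSum φ (swapCollision c) ≡ - extensionSum φ c
  extensionSum-swapCollision φ c ¬monic = flips (collision? (edgesOf c))
    where
    flips : (d : Dec (Collision (edgesOf c))) →
            extensionSum φ (uncollide (edgesOf c) d c) ≡ - extensionSum φ c
    flips (yes (a , b , _ , a≢b , ma , mb)) =
      extensionSum-headsSwapped φ a≢b (swapHeads-headsSwapped c ma mb)
    flips (no ¬coll) = contradiction (¬collision⇒injective {e = edgesOf c} ¬coll) ¬monic

  -- Reindexed along the involution, the sum over the families that are not edge-monic equals its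
  -- own negative, so it is 0 in the integers. Families fixed by the involution are covered by the
  -- same argument.
  monic-cancellation : ∀ φ → Σ.big families (extensionSum φ) ≡
                       Σ.big families λ c → Σ.when (edgeMonic? c) (extensionSum φ c)
  monic-cancellation φ = begin
    Σ.big families (extensionSum φ)
      -- The trivially true condition `yes tt` stands for the absent guard of the sum that is split.
      ≡⟨ Σ.big-cong families (λ c → Σ.when-split (yes tt) (edgeMonic? c)) ⟩
    Σ.big families (λ c → Σ.when (edgeMonic? c) (extensionSum φ c) + rest c)
      ≡⟨ Σ.big-∙ families ⟩
    Σ.big families (λ c → Σ.when (edgeMonic? c) (extensionSum φ c)) + Σ.big families rest
      ≡⟨ cong (Σ.big families (λ c → Σ.when (edgeMonic? c) (extensionSum φ c)) +_)
           (negation-fixed (Σ.big families rest) rest-neg) ⟩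
    Σ.big families (λ c → Σ.when (edgeMonic? c) (extensionSum φ c)) + 0ℤ
      ≡⟨ ℤ.+-identityʳ _ ⟩
    Σ.big families (λ c → Σ.when (edgeMonic? c) (extensionSum φ c)) ∎
    where
    open ≡-Reasoning
    rest : Family → ℤ
    rest c = Σ.when (¬? (edgeMonic? c)) (extensionSum φ c)
    rest-flips : ∀ c → rest (swapCollision c) ≡ - rest c
    rest-flips c = begin
      Σ.when (¬? (edgeMonic? (swapCollision c))) (extensionSum φ (swapCollision c))
        ≡⟨ cong (λ e → Σ.when (¬? (injective? e)) (extensionSum φ (swapCollision c)))
             (edgesOf-swapCollision c) ⟩
      Σ.when (¬? (edgeMonic? c)) (extensionSum φ (swapCollision c))
        ≡⟨ Σ.when-cong (¬? (edgeMonic? c)) (extensionSum-swapCollision φ c) ⟩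
      Σ.when (¬? (edgeMonic? c)) (- extensionSum φ c)
        ≡⟨ Σ-when-neg (¬? (edgeMonic? c)) (extensionSum φ c) ⟩
      - rest c ∎
    rest-neg : Σ.big families rest ≡ - Σ.big families rest
    rest-neg = begin
      Σ.big families rest
        ≡⟨ Σ.big-reindex families-enumerates
             (Vec.≡-dec (Maybe.≡-dec (Product.≡-dec Fin._≟_ Fin._≟_)))
             swapCollision swapCollision swapCollision-involutive swapCollision-involutive ⟨
      Σ.big families (rest ∘ swapCollision)
        ≡⟨ Σ.big-cong families rest-flips ⟩
      Σ.big families (λ c → - rest c)
        ≡⟨ Σ-neg families ⟩
      - Σ.big families rest ∎

-- Contributors as partial factorisations of permutations

alternating-+ : ∀ k l → alternating (k ℕ.+ l) ≡ alternating k · alternating l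
alternating-+ zero    l = refl
alternating-+ (suc k) l =
  trans (cong opposite (alternating-+ k l)) (sym (opposite-·ˡ (alternating k) (alternating l)))

module ContributorSum (G : OrientedHypergraph) where
  open OrientedHypergraph G
  open ContributorSign G
  open Fitting G
  open Cancellation G

  lookup-permOf : ∀ c v → lookup (permOf c) v ≡ Maybe.map (ς ∘ proj₂) (lookup c v)
  lookup-permOf c v = Vec.lookup-map v _ c

  fits-arc : ∀ v m s {w} → Fits v m s w → m ≡ just w ⊎ Maybe.map (ς ∘ proj₂) s ≡ just w
  fits-arc v (just _) nothing  refl       = inj₁ refl
  fits-arc v nothing  (just _) (_ , refl) = inj₂ refl

  fits-removed : ∀ v m s {w u} → Fits v m s w → m ≡ just u → w ≡ u
  fits-removed v (just _) nothing refl refl = refl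

  fits-step : ∀ v m s {w u} → Fits v m s w → Maybe.map (ς ∘ proj₂) s ≡ just u → w ≡ u
  fits-step v nothing (just _) (_ , refl) refl = refl

  fits-exclusive : ∀ v m s {w u u′} → Fits v m s w → m ≡ just u → Maybe.map (ς ∘ proj₂) s ≢ just u′
  fits-exclusive v (just _) nothing _ _ ()
  fits-exclusive v nothing  (just _) _ ()

  module FromPermutation {φ : PartialMap ∣V∣ ∣V∣} {c : Family} {π : Vec V ∣V∣}
                         (ext : Extends φ c π) where

    arc : ∀ v → Maps φ v (lookup π v) ⊎ Maps (permOf c) v (lookup π v)
    arc v rewrite lookup-permOf c v = fits-arc v (lookup φ v) (lookup c v) (ext v)

    arc-φ : ∀ v {w} → Maps φ v w → lookup π v ≡ w
    arc-φ v = fits-removed v (lookup φ v) (lookup c v) (ext v)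

    arc-c : ∀ v {w} → Maps (permOf c) v w → lookup π v ≡ w
    arc-c v m rewrite lookup-permOf c v = fits-step v (lookup φ v) (lookup c v) (ext v) m

    exclusive : ∀ v {w w′} → Maps φ v w → ¬ Maps (permOf c) v w′
    exclusive v m m′ rewrite lookup-permOf c v =
      fits-exclusive v (lookup φ v) (lookup c v) (ext v) m m′

    -- At each vertex `Fits` lets exactly one operand of `_<∣>_` be defined, with value
    -- `lookup π v`. This brings the even cycles of the contributor sign back to those of `π`.
    extension≡graph : extension φ c ≡ graph (lookup π)
    extension≡graph = lookup-extensional λ v → begin
      lookup (extension φ c) v
        ≡⟨ Vec.lookup-zipWith _<∣>_ v (permOf c) φ ⟩
      lookup (permOf c) v <∣> lookup φ v
        ≡⟨ cong (_<∣> lookup φ v) (lookup-permOf c v) ⟩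
      Maybe.map (ς ∘ proj₂) (lookup c v) <∣> lookup φ v
        ≡⟨ image v (lookup φ v) (lookup c v) (ext v) ⟩
      just (lookup π v)
        ≡⟨ maps-graph (lookup π) v ⟨
      lookup (graph (lookup π)) v ∎
      where
      open ≡-Reasoning
      image : ∀ v m s {w} → Fits v m s w → Maybe.map (ς ∘ proj₂) s <∣> m ≡ just w
      image v (just _) nothing  refl       = refl
      image v nothing  (just _) (_ , refl) = refl

    -- Injectivity of `π` makes both of its parts injective with disjoint images; surjectivity makes
    -- the two images cover all vertices.
    isReducedContributor : IsPermutation π → Injective φ × IsReducedContributor φ c
    isReducedContributor perm = φ-injective , record
      { domain    = domain
      ; steps     = steps
      ; injective = λ u v w mu mv → perm u v (trans (arc-c u mu) (sym (arc-c v mv)))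
      ; image⊆    = λ w (v , mv) (u , mu) → disjoint (perm u v (trans (arc-φ u mu) (sym (arc-c v mv)))) mu mv
      ; image⊇    = covers
      }
      where
      φ-injective : Injective φ
      φ-injective u v w mu mv = perm u v (trans (arc-φ u mu) (sym (arc-φ v mv)))
      domain : ∀ v → is-just (lookup c v) ≡ is-nothing (lookup φ v)
      domain v with lookup φ v | lookup c v | ext v
      ... | just _  | nothing | _ = refl
      ... | nothing | just _  | _ = refl
      steps : ∀ v → All (IsStep v) (lookup c v)
      steps v with lookup φ v | lookup c v | ext v
      ... | just _  | nothing | _       = nothing
      ... | nothing | just _  | (s , _) = just s
      disjoint : ∀ {u v w} → u ≡ v → Maps φ u w → ¬ Maps (permOf c) v w
      disjoint {u} refl = exclusive u
      covers : ∀ w → ¬ Image φ w → Image (permOf c) w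
      covers w ∉φ with injective⇒surjective (perm _ _) w
      ... | v , refl = v , [ (λ m → contradiction (v , m) ∉φ) , id ]′ (arc v)

  fits-functional : ∀ v m s {w w′} → Fits v m s w → Fits v m s w′ → w ≡ w′
  fits-functional v (just _) nothing  refl       refl       = refl
  fits-functional v nothing  (just _) (_ , refl) (_ , refl) = refl

  fits-exists : ∀ v m s → is-just s ≡ is-nothing m → All (IsStep v) s → ∃[ w ] Fits v m s w
  fits-exists v (just u) nothing  _ _        = u , refl
  fits-exists v nothing  (just _) _ (just s) = _ , s , refl

  module ToPermutation {φ : PartialMap ∣V∣ ∣V∣} {c : Family}
                       (φ-injective : Injective φ) (r : IsReducedContributor φ c) where
    open IsReducedContributor r

    private
      target : ∀ v → ∃[ w ] Fits v (lookup φ v) (lookup c v) w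
      target v = fits-exists v (lookup φ v) (lookup c v) (domain v) (steps v)

    permutation : Vec V ∣V∣
    permutation = tabulate (proj₁ ∘ target)

    permutation-extends : Extends φ c permutation
    permutation-extends v = subst (Fits v (lookup φ v) (lookup c v))
      (sym (Vec.lookup∘tabulate (proj₁ ∘ target) v)) (proj₂ (target v))

    private
      module Arcs = FromPermutation {φ} {c} {permutation} permutation-extends
      open Arcs using (arc)

    -- Two arcs of the same kind with a common head coincide by injectivity; arcs of different kinds
    -- have distinct heads because the images are disjoint.
    permutation-isPermutation : IsPermutation permutation
    permutation-isPermutation u v eq with arc u | arc v
    ... | inj₁ mu | inj₁ mv = φ-injective u v _ mu (subst (Maps φ v) (sym eq) mv)
    ... | inj₂ mu | inj₂ mv = injective u v _ mu (subst (Maps (permOf c) v) (sym eq) mv)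
    ... | inj₁ mu | inj₂ mv = contradiction (u , mu) (image⊆ _ (v , subst (Maps (permOf c) v) (sym eq) mv))
    ... | inj₂ mu | inj₁ mv = contradiction (v , subst (Maps φ v) (sym eq) mv) (image⊆ _ (u , mu))

    csgn≡ : csgn φ c ≡ toℤ (sgn (lookup permutation) · familySign c)
    csgn≡ = trans (^-alternating (ec ℕ.+ nc ℕ.+ bs)) (cong toℤ (begin
      alternating (ec ℕ.+ nc ℕ.+ bs)
        ≡⟨ alternating-+ (ec ℕ.+ nc) bs ⟩
      alternating (ec ℕ.+ nc) · alternating bs
        ≡⟨ cong (_· alternating bs) (alternating-+ ec nc) ⟩
      alternating ec · alternating nc · alternating bs
        ≡⟨ Sign.*-assoc (alternating ec) (alternating nc) (alternating bs) ⟩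
      alternating ec · (alternating nc · alternating bs)
        ≡⟨ cong₂ _·_
             (trans (cong (alternating ∘ evenCycles) Arcs.extension≡graph)
                    (alternating-evenCycles-graph (lookup permutation) (permutation-isPermutation _ _)))
             (sym (familySign≡ {c} steps injective)) ⟩
      sgn (lookup permutation) · familySign c ∎))
      where
      open ≡-Reasoning
      ec = evenCycles (extension φ c)
      nc = negativeComponents c
      bs = backsteps c

  -- A fitting `π` is determined vertex by vertex, so the sum has at most one term. That term is
  -- present exactly for the pairs selected on the right.
  extensionSum≡ : ∀ φ c → extensionSum φ c ≡
    Σ.when (injective? φ ×-dec isReducedContributor? φ c) (csgn φ c)
  extensionSum≡ φ c = evaluate (injective? φ ×-dec isReducedContributor? φ c)
    where
    open ≡-Reasoning
    valid? : ∀ π → Dec (IsPermutation π × Extends φ c π)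
    valid? π = isPermutation? π ×-dec extends? φ c π
    evaluate : (d : Dec (Injective φ × IsReducedContributor φ c)) →
               extensionSum φ c ≡ Σ.when d (csgn φ c)
    evaluate (no ¬r) = Σ.big-ε selfMaps λ {π} _ → Σ.when-no (valid? π) λ (perm , ext) →
      ¬r (FromPermutation.isReducedContributor {φ} {c} {π} ext perm)
    evaluate (yes (φ-injective , r)) = begin
      extensionSum φ c
        ≡⟨ Σ.big-single selfMaps-enumerates permutation (λ π π≢ → Σ.when-no (valid? π) λ (_ , ext) →
             π≢ (lookup-extensional λ v →
               fits-functional v (lookup φ v) (lookup c v) (ext v) (permutation-extends v))) ⟩
      Σ.when (valid? permutation) (toℤ (sgn (lookup permutation) · familySign c))
        ≡⟨ Σ.when-yes (valid? permutation) (permutation-isPermutation , permutation-extends) ⟩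
      toℤ (sgn (lookup permutation) · familySign c)
        ≡⟨ csgn≡ ⟨
      csgn φ c ∎
      where open ToPermutation {φ} {c} φ-injective r

  edgeMonicSum : ∀ φ → Σ.big families (extensionSum φ) ≡
    Σ.when (injective? φ) (Σ.big (edgeMonicContributors φ) (csgn φ))
  edgeMonicSum φ = begin
    Σ.big families (extensionSum φ)
      ≡⟨ monic-cancellation φ ⟩
    Σ.big families (λ c → Σ.when (edgeMonic? c) (extensionSum φ c))
      ≡⟨ Σ.big-cong families (λ c → trans
           (Σ.when-cong (edgeMonic? c) (λ _ → extensionSum≡ φ c))
           (reorder (injective? φ) (isReducedContributor? φ c) (edgeMonic? c))) ⟩
    Σ.big families (λ c → Σ.when (injective? φ)
      (Σ.when (isReducedContributor? φ c) (Σ.when (edgeMonic? c) (csgn φ c))))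
      ≡⟨ Σ.big-when (injective? φ) families ⟩
    Σ.when (injective? φ) (Σ.big families λ c →
      Σ.when (isReducedContributor? φ c) (Σ.when (edgeMonic? c) (csgn φ c)))
      ≡⟨ Σ.when-cong (injective? φ) (λ _ → trans
           (Σ.big-filter edgeMonic? (reducedContributors φ))
           (Σ.big-filter (isReducedContributor? φ) families)) ⟨
    Σ.when (injective? φ) (Σ.big (edgeMonicContributors φ) (csgn φ)) ∎
    where
    open ≡-Reasoning
    reorder : ∀ {p q r} {P : Set p} {Q : Set q} {R : Set r} (d : Dec P) (e : Dec Q) (f : Dec R) {z} →
              Σ.when f (Σ.when (d ×-dec e) z) ≡ Σ.when d (Σ.when e (Σ.when f z))
    reorder (yes _) (yes _) f = refl
    reorder (yes _) (no _)  f = Σ.when-ε f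
    reorder (no _)  e       f = Σ.when-ε f

-- The determinant over a commutative semiring receiving the integers

module Expansion
  (G : OrientedHypergraph) {c ℓ} (R : CommutativeSemiring c ℓ)
  (ι : ℤ → CommutativeSemiring.Carrier R)
  (ι-isHomomorphism : IsSemiringHomomorphism ℤ.+-*-rawSemiring (CommutativeSemiring.rawSemiring R) ι)
  (X : OrientedHypergraph.V G → OrientedHypergraph.V G → CommutativeSemiring.Carrier R)
  where

  open OrientedHypergraph G
  open ContributorSign G
  open Fitting G
  open ContributorSum G
  open CommutativeSemiring R hiding (zero) renaming
    (_+_ to _⊕_; _*_ to _⊗_; refl to ≈-refl; sym to ≈-sym; trans to ≈-trans)
  open IsSemiringHomomorphism ι-isHomomorphism
  open SemiringSums R
  open import Relation.Binary.Reasoning.Setoid setoid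
  open import Algebra.Properties.CommutativeSemigroup *-commutativeSemigroup using (x∙yz≈y∙xz)

  ι-∑ : (xs : List B) {f : B → ℤ} → ι (Σ.big xs f) ≈ ∑.big xs (ι ∘ f)
  ι-∑ []       = 0#-homo
  ι-∑ (b ∷ xs) = ≈-trans (+-homo _ _) (+-congˡ (ι-∑ xs))

  ι-when : (d : Dec P) {z : ℤ} → ι (Σ.when d z) ≈ ∑.when d (ι z)
  ι-when (yes _) = ≈-refl
  ι-when (no _)  = 0#-homo

  κ : Sign → Carrier
  κ s = ι (toℤ s)

  κ-· : ∀ s t → κ (s · t) ≈ κ s ⊗ κ t
  κ-· s t = ≈-trans (reflexive (cong ι (toℤ-* s t))) (*-homo (toℤ s) (toℤ t))

  κ-∏ : (xs : List B) {f : B → Sign} → κ (Π.big xs f) ≈ ∏.big xs (κ ∘ f)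
  κ-∏ []       = 1#-homo
  κ-∏ (b ∷ xs) = ≈-trans (κ-· _ _) (*-congˡ (κ-∏ xs))

  indeterminateOf : V → Maybe V → Carrier
  indeterminateOf v = maybe (X v) 1#

  monomial : PartialMap ∣V∣ ∣V∣ → Carrier
  monomial φ = ∏.big (allFin ∣V∣) λ v → indeterminateOf v (lookup φ v)

  entry : V → V → Maybe V → Maybe (I × I) → Carrier
  entry v w m s = ∑.when (fits? v m s w) (indeterminateOf v m ⊗ κ (entrySign s))

  -- Pairs that do not fit contribute 0. With this padding the index set is the same for all
  -- entries, so that the product over `v` expands into independent choices.
  entry-expand : ∀ v w → X v w ⊕ ι (- laplacian v w) ≈
    ∑.big (allMaybe (allFin ∣V∣)) λ m → ∑.big (allMaybe incidencePairs) λ s → entry v w m s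
  entry-expand v w = begin
    X v w ⊕ ι (- laplacian v w)
      ≈⟨ +-comm _ _ ⟩
    ι (- laplacian v w) ⊕ X v w
      ≈⟨ +-cong kept removed ⟩
    ∑.big (allMaybe incidencePairs) (entry v w nothing) ⊕
    ∑.big (map just (allFin ∣V∣)) (λ m → ∑.big (allMaybe incidencePairs) (entry v w m)) ∎
    where
    kept : ι (- laplacian v w) ≈ ∑.big (allMaybe incidencePairs) (entry v w nothing)
    kept = begin
      ι (- laplacian v w)
        ≡⟨ cong ι (-laplacian≡ v w) ⟩
      ι (Σ.big incidencePairs (λ s → Σ.when (fits? v nothing (just s) w) (toℤ (stepSign s))))
        ≈⟨ ι-∑ incidencePairs ⟩
      ∑.big incidencePairs (λ s → ι (Σ.when (fits? v nothing (just s) w) (toℤ (stepSign s))))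
        ≈⟨ ∑.big-cong incidencePairs (λ s → ≈-trans (ι-when (fits? v nothing (just s) w))
             (∑.when-cong (fits? v nothing (just s) w) λ _ → ≈-sym (*-identityˡ _))) ⟩
      ∑.big incidencePairs (λ s → entry v w nothing (just s))
        ≡⟨ ∑.big-map just incidencePairs ⟨
      ∑.big (map just incidencePairs) (entry v w nothing)
        ≈⟨ +-identityˡ _ ⟨
      ∑.big (allMaybe incidencePairs) (entry v w nothing) ∎
    row : ∀ u → ∑.big (allMaybe incidencePairs) (entry v w (just u)) ≈ ∑.when (u Fin.≟ w) (X v u)
    row u = begin
      entry v w (just u) nothing ⊕ ∑.big (map just incidencePairs) (entry v w (just u))
        ≈⟨ +-cong (∑.when-cong (u Fin.≟ w) λ _ → ≈-trans (*-congˡ 1#-homo) (*-identityʳ _))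
             (≈-trans (reflexive (∑.big-map just incidencePairs))
                      (∑.big-ε incidencePairs λ _ → ≈-refl)) ⟩
      ∑.when (u Fin.≟ w) (X v u) ⊕ 0#
        ≈⟨ +-identityʳ _ ⟩
      ∑.when (u Fin.≟ w) (X v u) ∎
    removed : X v w ≈
      ∑.big (map just (allFin ∣V∣)) (λ m → ∑.big (allMaybe incidencePairs) (entry v w m))
    removed = begin
      X v w
        ≡⟨ ∑.when-yes (w Fin.≟ w) refl ⟨
      ∑.when (w Fin.≟ w) (X v w)
        ≈⟨ ∑.big-single (allFin-enumerates ∣V∣) w (λ u u≢w →
             reflexive (∑.when-no (u Fin.≟ w) u≢w)) ⟨
      ∑.big (allFin ∣V∣) (λ u → ∑.when (u Fin.≟ w) (X v u))
        ≈⟨ ∑.big-cong (allFin ∣V∣) row ⟨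
      ∑.big (allFin ∣V∣) (λ u → ∑.big (allMaybe incidencePairs) (entry v w (just u)))
        ≡⟨ ∑.big-map just (allFin ∣V∣) ⟨
      ∑.big (map just (allFin ∣V∣)) (λ m → ∑.big (allMaybe incidencePairs) (entry v w m)) ∎

  product-expand : (π : Vec V ∣V∣) →
    ∏.big (allFin ∣V∣) (λ v → X v (lookup π v) ⊕ ι (- laplacian v (lookup π v))) ≈
    ∑.big partialMaps λ φ → ∑.big families λ c →
      ∑.when (extends? φ c π) (monomial φ ⊗ κ (familySign c))
  product-expand π = begin
    ∏.big Vs (λ v → X v (lookup π v) ⊕ ι (- laplacian v (lookup π v)))
      ≈⟨ ∏.big-cong Vs (λ v → entry-expand v (lookup π v)) ⟩
    ∏.big Vs (λ v → ∑.big (allMaybe Vs) λ m → ∑.big (allMaybe incidencePairs) λ s →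
      entry v (lookup π v) m s)
      -- Distributivity is used twice: the choices of `m` in all rows form `φ`, and then, for each
      -- `φ`, the choices of `s` form `c`.
      ≈⟨ ∏-∑ ∣V∣ (allMaybe Vs) _ ⟩
    ∑.big partialMaps (λ φ → ∏.big Vs λ v → ∑.big (allMaybe incidencePairs) λ s →
      entry v (lookup π v) (lookup φ v) s)
      ≈⟨ ∑.big-cong partialMaps (λ φ → ∏-∑ ∣V∣ (allMaybe incidencePairs) _) ⟩
    ∑.big partialMaps (λ φ → ∑.big families λ c → ∏.big Vs λ v →
      entry v (lookup π v) (lookup φ v) (lookup c v))
      ≈⟨ ∑.big-cong partialMaps (λ φ → ∑.big-cong families λ c →
           ≈-trans (∏-when (λ v → fits? v (lookup φ v) (lookup c v) (lookup π v)) (extends? φ c π) _)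
             (∑.when-cong (extends? φ c π) λ _ →
               ≈-trans (∏.big-∙ Vs) (*-congˡ (≈-sym (κ-∏ Vs))))) ⟩
    ∑.big partialMaps (λ φ → ∑.big families λ c →
      ∑.when (extends? φ c π) (monomial φ ⊗ κ (familySign c))) ∎
    where Vs = allFin ∣V∣

  det-expand :
    ∑.big (permutations ∣V∣) (λ π → κ (sgn (lookup π)) ⊗
      ∏.big (allFin ∣V∣) λ v → X v (lookup π v) ⊕ ι (- laplacian v (lookup π v))) ≈
    ∑.big partialMaps λ φ → monomial φ ⊗ ι (Σ.big families (extensionSum φ))
  det-expand = begin
    ∑.big (permutations ∣V∣) (λ π → κ (sgn (lookup π)) ⊗
      ∏.big (allFin ∣V∣) λ v → X v (lookup π v) ⊕ ι (- laplacian v (lookup π v)))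
      ≈⟨ ∑.big-cong (permutations ∣V∣) (λ π → ≈-trans (*-congˡ (product-expand π))
           (≈-trans (∑-distribˡ _ partialMaps)
             (∑.big-cong partialMaps λ φ → ∑-distribˡ _ families))) ⟩
    ∑.big (permutations ∣V∣) (λ π → ∑.big partialMaps λ φ → ∑.big families λ c → term φ c π)
      ≈⟨ ≈-trans (∑.big-swap (permutations ∣V∣) partialMaps)
           (∑.big-cong partialMaps λ φ → ∑.big-swap (permutations ∣V∣) families) ⟩
    ∑.big partialMaps (λ φ → ∑.big families λ c → ∑.big (permutations ∣V∣) λ π → term φ c π)
      ≈⟨ ∑.big-cong partialMaps (λ φ → ∑.big-cong families λ c → collect φ c) ⟩
    ∑.big partialMaps (λ φ → ∑.big families λ c → monomial φ ⊗ ι (extensionSum φ c))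
      ≈⟨ ∑.big-cong partialMaps (λ φ →
           ≈-trans (*-congˡ (ι-∑ families)) (∑-distribˡ (monomial φ) families)) ⟨
    ∑.big partialMaps (λ φ → monomial φ ⊗ ι (Σ.big families (extensionSum φ))) ∎
    where
    term : PartialMap ∣V∣ ∣V∣ → Family → Vec V ∣V∣ → Carrier
    term φ c π = κ (sgn (lookup π)) ⊗ ∑.when (extends? φ c π) (monomial φ ⊗ κ (familySign c))
    regroup : (d : Dec P) (e : Dec Q) (s t : Sign) (z : Carrier) →
              ∑.when d (κ s ⊗ ∑.when e (z ⊗ κ t)) ≈ z ⊗ ι (Σ.when (d ×-dec e) (toℤ (s · t)))
    regroup (yes _) (yes _) s t z = ≈-trans (x∙yz≈y∙xz _ _ _) (*-congˡ (≈-sym (κ-· s t)))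
    regroup (yes _) (no _)  s t z = ≈-trans (zeroʳ _) (≈-sym (≈-trans (*-congˡ 0#-homo) (zeroʳ z)))
    regroup (no _)  _       s t z = ≈-sym (≈-trans (*-congˡ 0#-homo) (zeroʳ z))
    collect : ∀ φ c → ∑.big (permutations ∣V∣) (term φ c) ≈ monomial φ ⊗ ι (extensionSum φ c)
    collect φ c = begin
      ∑.big (permutations ∣V∣) (term φ c)
        ≈⟨ ∑.big-filter isPermutation? selfMaps ⟩
      ∑.big selfMaps (λ π → ∑.when (isPermutation? π) (term φ c π))
        ≈⟨ ∑.big-cong selfMaps (λ π → regroup (isPermutation? π) (extends? φ c π) _ _ _) ⟩
      ∑.big selfMaps (λ π → monomial φ ⊗
        ι (Σ.when (isPermutation? π ×-dec extends? φ c π) (toℤ (sgn (lookup π) · familySign c))))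
        ≈⟨ ≈-trans (*-congˡ (ι-∑ selfMaps)) (∑-distribˡ (monomial φ) selfMaps) ⟨
      monomial φ ⊗ ι (extensionSum φ c) ∎

  det-minors :
    ∑.big (permutations ∣V∣) (λ π → κ (sgn (lookup π)) ⊗
      ∏.big (allFin ∣V∣) λ v → X v (lookup π v) ⊕ ι (- laplacian v (lookup π v))) ≈
    ∑.big (pairs ∣V∣) λ φ → ι (Σ.big (edgeMonicContributors φ) (csgn φ)) ⊗ monomial φ
  det-minors = begin
    ∑.big (permutations ∣V∣) (λ π → κ (sgn (lookup π)) ⊗
      ∏.big (allFin ∣V∣) λ v → X v (lookup π v) ⊕ ι (- laplacian v (lookup π v)))
      ≈⟨ det-expand ⟩
    ∑.big partialMaps (λ φ → monomial φ ⊗ ι (Σ.big families (extensionSum φ)))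
      ≈⟨ ∑.big-cong partialMaps minor ⟩
    ∑.big partialMaps (λ φ → ∑.when (injective? φ) (coefficient φ ⊗ monomial φ))
      ≈⟨ ∑.big-filter injective? partialMaps ⟨
    ∑.big (pairs ∣V∣) (λ φ → coefficient φ ⊗ monomial φ) ∎
    where
    coefficient : PartialMap ∣V∣ ∣V∣ → Carrier
    coefficient φ = ι (Σ.big (edgeMonicContributors φ) (csgn φ))
    minor : ∀ φ → monomial φ ⊗ ι (Σ.big families (extensionSum φ)) ≈
                  ∑.when (injective? φ) (coefficient φ ⊗ monomial φ)
    minor φ = begin
      monomial φ ⊗ ι (Σ.big families (extensionSum φ))
        -- The coefficient vanishes when `φ` is not injective, which cuts the partial maps down to
        -- `pairs`.
        ≡⟨ cong (λ z → monomial φ ⊗ ι z) (edgeMonicSum φ) ⟩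
      monomial φ ⊗ ι (Σ.when (injective? φ) (Σ.big (edgeMonicContributors φ) (csgn φ)))
        ≈⟨ *-comm _ _ ⟩
      ι (Σ.when (injective? φ) (Σ.big (edgeMonicContributors φ) (csgn φ))) ⊗ monomial φ
        ≈⟨ *-congʳ (ι-when (injective? φ)) ⟩
      ∑.when (injective? φ) (coefficient φ) ⊗ monomial φ
        ≈⟨ when-*ˡ (injective? φ) (coefficient φ) (monomial φ) ⟩
      ∑.when (injective? φ) (coefficient φ ⊗ monomial φ) ∎

signOf≡ : ∀ {n} (π : Vec (Fin n) n) → signOf (MatrixPolyRing n) π ≡ constant (toℤ (sgn (lookup π)))
signOf≡ {n} π = begin
  signOf (MatrixPolyRing n) π
    ≡⟨ if-float (constant ∘ toℤ) (does (2 ∣? inversions π)) ⟨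
  constant (toℤ (if does (2 ∣? inversions π) then Sign.+ else Sign.-))
    ≡⟨ cong (constant ∘ toℤ)
         (trans (alternating-parity (inversions π)) (alternating-inversions π)) ⟩
  constant (toℤ (sgn (lookup π))) ∎
  where open ≡-Reasoning

theorem2p2p4 : (G : OrientedHypergraph) →
    let open OrientedHypergraph G in
    let open RawRing (MatrixPolyRing ∣V∣) in
    totalMinorPolynomial laplacian ≈
    sumOver (MatrixPolyRing ∣V∣) (pairs ∣V∣) λ φ →
    constant (sumOver ℤ.+-*-rawRing (edgeMonicContributors φ) λ c → csgn φ c)
    * monomialOf φ
theorem2p2p4 G μ = trans
  (cong (λ ts → coeff (foldr _++_ [] ts) μ)
        (List.map-cong (λ π → cong (λ s → s ·ₚ entries π) (signOf≡ π)) (permutations ∣V∣)))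
  (det-minors μ)
  where
  open OrientedHypergraph G
  open RawRing (MatrixPolyRing ∣V∣) using () renaming (_*_ to _·ₚ_; _+_ to _+ₚ_)
  open Polynomials (∣V∣ ℕ.* ∣V∣) using (commutativeSemiring; constant-isHomomorphism)
  open Expansion G commutativeSemiring constant constant-isHomomorphism x using (det-minors)
  entries : Vec V ∣V∣ → Poly (∣V∣ ℕ.* ∣V∣)
  -- The negative of a constant polynomial computes to the constant of the negated integer, so this
  -- is the product in the determinant by reduction. All subtraction thereby takes place in the
  -- integers, and a semiring suffices for the expansion.
  entries π = prodOver (MatrixPolyRing ∣V∣) (allFin ∣V∣) λ v →
    x v (lookup π v) +ₚ constant (- laplacian v (lookup π v))
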